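{- Let $S$ be a bipartite signed digraph of order $n$ in which every directed cycle of length $\equiv 0 \pmod 4$ is negative and every directed cycle of length $\equiv 2\pmod 4$ is positive. Then $$\phi_S(z)=z^n+\sum_{j=1}^{\lfloor n/2\rfloor}(-1)^j c_{2j}(S)\,z^{n-2j},$$ where $c_{2j}(S)=|\pounds_{2j}|$ is the number of linear subsidigraphs of $S$ of order $2j$.
   Context: A signed digraph $S$ is a digraph (no loops or multiple arcs) with a sign $\pm1$ on each arc; its adjacency matrix $A(S)=(a_{ij})$ has $a_{ij}$ equal to the sign of the arc from $v_i$ to $v_j$ if it exists and $0$ otherwise, and $\phi_S(z)=\det(zI-A(S))$. $S$ is bipartite if its underlying digraph is bipartite. The sign of a directed cycle is the product of the signs of its arcs; a cycle is positive (negative) if its sign is $+1$ ($-1$). A linear subsidigraph is a subsidigraph in which every vertex has indegree and outdegree one (a vertex-disjoint union of directed cycles); its order is its number of vertices. -}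

module Defs where

open import Data.Nat as ℕ using (ℕ; zero; suc; _∸_; _%_)
open import Data.Integer as ℤ using (ℤ; 0ℤ; 1ℤ; -1ℤ)
open import Data.Fin using (Fin; zero; suc; toℕ; punchIn)
open import Data.List using (List; []; _∷_; [_]; _++_; map; foldr; length; filterᵇ; concatMap; allFin)
open import Data.List.Relation.Unary.All using (All)
open import Data.List.Relation.Unary.Unique.Propositional using (Unique)
open import Data.Bool using (Bool; true; false; _∧_; if_then_else_)
open import Data.Maybe using (Maybe; just; nothing)
open import Data.Sign using (Sign)
open import Data.Product using (_×_; _,_; ∃)
open import Relation.Binary.PropositionalEquality using (_≡_; _≢_)
import Relation.Nullary
import Data.Fin
import Data.List

-- Signed digraphs on the vertex set Fin n.
-- S i j = nothing : no arc from v_i to v_j;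
-- S i j = just s  : an arc from v_i to v_j with sign s.
-- No loops: S i i = nothing (imposed as a hypothesis in the theorem).

SignedDigraph : ℕ → Set
SignedDigraph n = Fin n → Fin n → Maybe Sign

Loopless : ∀ {n} → SignedDigraph n → Set
Loopless {n} S = (i : Fin n) → S i i ≡ nothing

signToℤ : Sign → ℤ
signToℤ Sign.+ = 1ℤ
signToℤ Sign.- = -1ℤ

adj : ∀ {n} → SignedDigraph n → Fin n → Fin n → ℤ
adj S i j with S i j
... | nothing = 0ℤ
... | just s  = signToℤ s

Bipartite : ∀ {n} → SignedDigraph n → Set
Bipartite {n} S = ∃ λ (col : Fin n → Bool) →
  (i j : Fin n) → S i j ≢ nothing → col i ≢ col j

consecutive : ∀ {A : Set} → List A → List (A × A)
consecutive []           = []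
consecutive (x ∷ [])     = []
consecutive (x ∷ y ∷ xs) = (x , y) ∷ consecutive (y ∷ xs)

cycleArcs : ∀ {A : Set} → A → List A → List (A × A)
cycleArcs v vs = consecutive (v ∷ vs ++ [ v ])

IsArc : ∀ {n} → SignedDigraph n → Fin n × Fin n → Set
IsArc S (i , j) = S i j ≢ nothing

IsDirectedCycle : ∀ {n} → SignedDigraph n → Fin n → List (Fin n) → Set
IsDirectedCycle S v vs = Unique (v ∷ vs) × All (IsArc S) (cycleArcs v vs)

cycleLength : ∀ {n} → Fin n → List (Fin n) → ℕ
cycleLength v vs = length (v ∷ vs)

cycleSign : ∀ {n} → SignedDigraph n → Fin n → List (Fin n) → ℤ
cycleSign S v vs = foldr (λ { (i , j) acc → adj S i j ℤ.* acc }) 1ℤ (cycleArcs v vs)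

-- Polynomials in z with integer coefficients, as coefficient lists
-- (constant term first).  Equality of polynomials = equality of all coefficients.

Poly : Set
Poly = List ℤ

_+P_ : Poly → Poly → Poly
[]      +P q       = q
p       +P []      = p
(a ∷ p) +P (b ∷ q) = (a ℤ.+ b) ∷ (p +P q)

scaleP : ℤ → Poly → Poly
scaleP c = map (c ℤ.*_)

_*P_ : Poly → Poly → Poly
[]      *P q = []
(a ∷ p) *P q = scaleP a q +P (0ℤ ∷ (p *P q))

constP : ℤ → Poly
constP c = [ c ]

monomial : ℕ → Poly
monomial zero    = [ 1ℤ ]
monomial (suc k) = 0ℤ ∷ monomial k

coeff : Poly → ℕ → ℤ
coeff []      _       = 0ℤ
coeff (a ∷ p) zero    = a
coeff (a ∷ p) (suc k) = coeff p k

sumP : ∀ {A : Set} → (A → Poly) → List A → Poly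
sumP f = foldr (λ x acc → f x +P acc) []

altSign : ℕ → ℤ
altSign zero          = 1ℤ
altSign (suc zero)    = -1ℤ
altSign (suc (suc k)) = altSign k

det : (n : ℕ) → (Fin n → Fin n → Poly) → Poly
det zero    M = [ 1ℤ ]
det (suc n) M = sumP (λ j → scaleP (altSign (toℕ j)) (M zero j *P det n (λ r c → M (suc r) (punchIn j c)))) (allFin (suc n))

charMatrix : ∀ {n} → SignedDigraph n → Fin n → Fin n → Poly
charMatrix S i j with i Data.Fin.≟ j
... | Relation.Nullary.yes _ = ℤ.- adj S i j ∷ 1ℤ ∷ []
... | Relation.Nullary.no  _ = [ ℤ.- adj S i j ]

charPoly : ∀ {n} → SignedDigraph n → Poly
charPoly {n} S = det n (charMatrix S)

-- Linear subsidigraphs.  A subdigraph all of whose vertices have indegree and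
-- outdegree one is determined by its arc set E (its vertices are exactly the
-- endpoints of arcs of E).  E is given by its indicator E i j = true iff the arc
-- v_i → v_j is in the subdigraph.

countTrue : ∀ {n} → (Fin n → Bool) → ℕ
countTrue f = length (filterᵇ f (allFin _))

outdeg : ∀ {n} → (Fin n → Fin n → Bool) → Fin n → ℕ
outdeg E i = countTrue (λ j → E i j)

indeg : ∀ {n} → (Fin n → Fin n → Bool) → Fin n → ℕ
indeg E j = countTrue (λ i → E i j)

isArcᵇ : ∀ {n} → SignedDigraph n → Fin n → Fin n → Bool
isArcᵇ S i j with S i j
... | nothing = false
... | just _  = true

implies : Bool → Bool → Bool
implies true  b = b
implies false _ = true

allFinᵇ : ∀ {n} → (Fin n → Bool) → Bool
allFinᵇ f = foldr (λ i acc → f i ∧ acc) true (allFin _)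

-- every vertex has (indeg, outdeg) ∈ {(0,0), (1,1)} w.r.t. E; vertices with (1,1)
-- are the vertices of the linear subsidigraph
degreeOK : ℕ → ℕ → Bool
degreeOK 0 0 = true
degreeOK 1 1 = true
degreeOK _ _ = false

isLinearSubᵇ : ∀ {n} → SignedDigraph n → (Fin n → Fin n → Bool) → Bool
isLinearSubᵇ S E =
  allFinᵇ (λ i → allFinᵇ (λ j → implies (E i j) (isArcᵇ S i j)))
  ∧ allFinᵇ (λ i → degreeOK (indeg E i) (outdeg E i))

-- order = number of vertices = number of vertices of outdegree one
order : ∀ {n} → (Fin n → Fin n → Bool) → ℕ
order E = countTrue (λ i → degreeOK 1 (outdeg E i))

allFuns : ∀ {A : Set} (m : ℕ) → List A → List (Fin m → A)
allFuns zero    xs = [ (λ ()) ]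
allFuns (suc m) xs = concatMap (λ x → map (λ f → λ { zero → x ; (suc i) → f i }) (allFuns m xs)) xs

allArcSets : (n : ℕ) → List (Fin n → Fin n → Bool)
allArcSets n = allFuns n (allFuns n (true ∷ false ∷ []))

c : ∀ {n} → SignedDigraph n → ℕ → ℕ
c {n} S k = length (filterᵇ (λ E → isLinearSubᵇ S E ∧ (order E ℕ.≡ᵇ k)) (allArcSets n))

rhsPoly : ∀ {n} → SignedDigraph n → Poly
rhsPoly {n} S = monomial n +P sumP (λ j → scaleP (altSign j ℤ.* ℤ.+ c S (2 ℕ.* j)) (monomial (n ∸ 2 ℕ.* j))) (Data.List.map suc (Data.List.upTo (n ℕ./ 2)))

{-# OPTIONS --safe #-}
module Submission where

-- Let κ be the ±1-valued function of the colour of a vertex. Multiplying the sign of every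
-- arc by κ of its tail multiplies the sign of a cycle of length ℓ by (-1)^(ℓ/2), so after this
-- switching every directed cycle is negative. When all cycles, loops included, are
-- negative with respect to signs s, the determinant of the matrix with entries -s·p equals the
-- permanent of (p). This is proved by expanding along the first row and contracting the arc
-- from the first vertex to the chosen column: contraction keeps all cycles negative, and
-- restoring the diagonal costs the sign of a rotation of the columns. Here p is z on the
-- diagonal and κ of the tail on arcs. A term of the permanent is a linear
-- subsidigraph L, and it contributes (-1)^m z^(n-|L|), where m is the number of vertices of L of
-- one colour, which is |L|/2 because arcs join different colours.

open import Defs
open import Data.Nat as ℕ using (ℕ; zero; suc; _%_)
open import Data.Nat.DivMod using (_/_; /-monoˡ-≤; m*n/n≡m)
import Data.Nat.Properties as ℕₚ
open import Data.Integer as ℤ using (ℤ; 0ℤ; 1ℤ; -1ℤ; _+_; _*_; -_; _^_)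
import Data.Integer.Properties as ℤₚ
open import Data.Integer.Tactic.RingSolver using (solve-∀)
open import Data.Fin using (Fin; zero; suc; toℕ; punchIn; _≟_)
open import Data.Bool using (Bool; true; false; _∧_; _∨_; not; if_then_else_)
import Data.Bool.Properties as Boolₚ
open import Data.List using (List; []; _∷_; [_]; _++_; map; foldr; length; filterᵇ; concatMap; allFin; tabulate; upTo; applyUpTo)
import Data.List.Properties as Listₚ
open import Data.List.Membership.Propositional.Properties using (∈-++⁻; ∈-∃++; ∈-insert)
open import Data.List.Relation.Unary.All as All using (All; []; _∷_)
import Data.List.Relation.Unary.All.Properties as Allₚ
open import Data.List.Relation.Unary.AllPairs using ([]; _∷_)
open import Data.List.Relation.Unary.Unique.Propositional using (Unique)
open import Data.List.Relation.Unary.Unique.Propositional.Properties using (allFin⁺)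
open import Data.List.Relation.Binary.Permutation.Propositional using (_↭_; ↭-refl; ↭-sym; ↭-trans; prep; ↭⇒↭ₛ)
open import Data.List.Relation.Binary.Permutation.Propositional.Properties using (drop-mid; ∈-resp-↭; ↭-map-inv) renaming (shift to ↭-shift)
import Data.List.Relation.Binary.Permutation.Setoid.Properties as Permutationₛ
open import Data.Maybe using (just; nothing)
open import Data.Sign using (Sign)
open import Data.Product using (_×_; _,_; ∃; ∃₂)
open import Data.Sum using (_⊎_; inj₁; inj₂)
open import Data.Empty using (⊥-elim)
open import Function using (_∘_; id)
open import Function.Bundles using (mk⇔)
open import Relation.Nullary using (does; yes; no; ¬_)
open import Relation.Nullary.Decidable using (dec-true; dec-false)
open import Relation.Binary.PropositionalEquality hiding ([_])

-- Finite sums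

-- In the determinant a cycle of length l of a permutation gives (-1)^(l-1) from the signature,
-- (-1)^l from the minus signs of the entries, and its own sign. If that sign is -1 the product is
-- 1, so every permutation counts positively and a permanent results. Arguing this way would require
-- decomposing permutations into cycles. Contraction replaces the decomposition by an induction in
-- which only the parity of a column move has to be tracked. The price is a statement more general
-- than one about a matrix with its own diagonal: after a contraction the arcs into a vertex and the
-- arcs out of it belong to different indices, and the sign of the absorbed arc must be remembered.
-- This is the origin of `Site`. The number of components of a subsidigraph never enters. The factor
-- (-1)^m is all that the switching leaves behind. Functions can be compared only pointwise, so sums
-- over words and arc sets carry proofs that the summand respects pointwise equality.

⟦_⟧ : Bool → ℤ
⟦ true ⟧  = 1ℤ
⟦ false ⟧ = 0ℤ

⟦∧⟧ : ∀ a b → ⟦ a ∧ b ⟧ ≡ ⟦ a ⟧ * ⟦ b ⟧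
⟦∧⟧ true  b = sym (ℤₚ.*-identityˡ ⟦ b ⟧)
⟦∧⟧ false b = refl

module _ {A : Set} where

  ∑ : List A → (A → ℤ) → ℤ
  ∑ []       f = 0ℤ
  ∑ (x ∷ xs) f = f x + ∑ xs f

  ∑-cong : ∀ xs {f g : A → ℤ} → (∀ x → f x ≡ g x) → ∑ xs f ≡ ∑ xs g
  ∑-cong []       f≗g = refl
  ∑-cong (x ∷ xs) f≗g = cong₂ _+_ (f≗g x) (∑-cong xs f≗g)

  ∑-zero : ∀ xs {f : A → ℤ} → (∀ x → f x ≡ 0ℤ) → ∑ xs f ≡ 0ℤ
  ∑-zero []       f≗0 = refl
  ∑-zero (x ∷ xs) f≗0 = cong₂ _+_ (f≗0 x) (∑-zero xs f≗0)

  ∑-+ : ∀ xs (f g : A → ℤ) → ∑ xs (λ x → f x + g x) ≡ ∑ xs f + ∑ xs g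
  ∑-+ []       f g = refl
  ∑-+ (x ∷ xs) f g = trans (cong (f x + g x +_) (∑-+ xs f g)) (lemma (f x) (g x) (∑ xs f) (∑ xs g))
    where
    lemma : ∀ a b c d → a + b + (c + d) ≡ a + c + (b + d)
    lemma = solve-∀

  ∑-*ˡ : ∀ xs a (f : A → ℤ) → ∑ xs (λ x → a * f x) ≡ a * ∑ xs f
  ∑-*ˡ []       a f = sym (ℤₚ.*-zeroʳ a)
  ∑-*ˡ (x ∷ xs) a f = trans (cong (a * f x +_) (∑-*ˡ xs a f)) (sym (ℤₚ.*-distribˡ-+ a (f x) (∑ xs f)))

  ∑-++ : ∀ xs ys (f : A → ℤ) → ∑ (xs ++ ys) f ≡ ∑ xs f + ∑ ys f
  ∑-++ []       ys f = sym (ℤₚ.+-identityˡ _)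
  ∑-++ (x ∷ xs) ys f = trans (cong (f x +_) (∑-++ xs ys f)) (sym (ℤₚ.+-assoc (f x) _ _))

  length-filterᵇ : ∀ p (xs : List A) → ℤ.+ length (filterᵇ p xs) ≡ ∑ xs (⟦_⟧ ∘ p)
  length-filterᵇ p []       = refl
  length-filterᵇ p (x ∷ xs) with p x
  ... | true  = cong (1ℤ +_) (length-filterᵇ p xs)
  ... | false = trans (length-filterᵇ p xs) (sym (ℤₚ.+-identityˡ _))

module _ {A B : Set} where

  ∑-swap : ∀ (xs : List A) (ys : List B) (f : A → B → ℤ) →
           ∑ xs (λ x → ∑ ys (f x)) ≡ ∑ ys (λ y → ∑ xs (λ x → f x y))
  ∑-swap []       ys f = sym (∑-zero ys (λ _ → refl))
  ∑-swap (x ∷ xs) ys f = trans (cong (∑ ys (f x) +_) (∑-swap xs ys f)) (sym (∑-+ ys (f x) _))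

  ∑-map : ∀ (h : A → B) xs (f : B → ℤ) → ∑ (map h xs) f ≡ ∑ xs (f ∘ h)
  ∑-map h []       f = refl
  ∑-map h (x ∷ xs) f = cong (f (h x) +_) (∑-map h xs f)

  ∑-concatMap : ∀ (h : A → List B) xs (f : B → ℤ) → ∑ (concatMap h xs) f ≡ ∑ xs (λ x → ∑ (h x) f)
  ∑-concatMap h []       f = refl
  ∑-concatMap h (x ∷ xs) f = trans (∑-++ (h x) _ f) (cong (∑ (h x) f +_) (∑-concatMap h xs f))

  ∑-tabulate-cong : ∀ {n} {h : Fin n → A} {h′ : Fin n → B} {f : A → ℤ} {f′ : B → ℤ} →
                    (∀ i → f (h i) ≡ f′ (h′ i)) → ∑ (tabulate h) f ≡ ∑ (tabulate h′) f′
  ∑-tabulate-cong {zero}  eq = refl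
  ∑-tabulate-cong {suc n} eq = cong₂ _+_ (eq zero) (∑-tabulate-cong (eq ∘ suc))

∑-suc : ∀ {n} (f : Fin (suc n) → ℤ) → ∑ (allFin (suc n)) f ≡ f zero + ∑ (allFin n) (f ∘ suc)
∑-suc {n} f = cong (f zero +_) (∑-tabulate-cong {h = suc} {h′ = id} {f = f} {f′ = f ∘ suc} (λ _ → refl))

infix 4 _==_
_==_ : ∀ {n} → Fin n → Fin n → Bool
i == j = does (i ≟ j)

==-refl : ∀ {n} (i : Fin n) → (i == i) ≡ true
==-refl i = dec-true (i ≟ i) refl

==-≢ : ∀ {n} {i j : Fin n} → i ≢ j → (i == j) ≡ false
==-≢ {i = i} {j} = dec-false (i ≟ j)

∑-δ : ∀ {n} (i : Fin n) (f : Fin n → ℤ) → ∑ (allFin n) (λ j → ⟦ i == j ⟧ * f j) ≡ f i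
∑-δ {suc n} zero f = begin
  ∑ (allFin (suc n)) (λ j → ⟦ zero == j ⟧ * f j) ≡⟨ ∑-suc (λ j → ⟦ zero == j ⟧ * f j) ⟩
  1ℤ * f zero + ∑ (allFin n) (λ _ → 0ℤ)          ≡⟨ cong₂ _+_ (ℤₚ.*-identityˡ (f zero)) (∑-zero (allFin n) (λ _ → refl)) ⟩
  f zero + 0ℤ                                    ≡⟨ ℤₚ.+-identityʳ (f zero) ⟩
  f zero                                         ∎
  where open ≡-Reasoning
∑-δ {suc n} (suc i) f = trans (∑-suc (λ j → ⟦ suc i == j ⟧ * f j)) (trans (ℤₚ.+-identityˡ _) (∑-δ i (f ∘ suc)))

-- Sums over words and over arc sets

infixr 5 _◂_
_◂_ : ∀ {A : Set} {m} → A → (Fin m → A) → Fin (suc m) → A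
(x ◂ f) zero    = x
(x ◂ f) (suc i) = f i

-- The functions listed by `allFuns` agree with `x ◂ f` only pointwise, hence the condition on `g`.
∑-allFuns : ∀ {A : Set} m (xs : List A) (g : (Fin (suc m) → A) → ℤ) →
            (∀ {f f′} → f ≗ f′ → g f ≡ g f′) →
            ∑ (allFuns (suc m) xs) g ≡ ∑ xs (λ x → ∑ (allFuns m xs) (λ f → g (x ◂ f)))
∑-allFuns m xs g g-ext = trans (∑-concatMap _ xs g) (∑-cong xs (λ x →
  trans (∑-map _ (allFuns m xs) g) (∑-cong (allFuns m xs) (λ f → g-ext (λ { zero → refl ; (suc i) → refl })))))

bools : List Bool
bools = true ∷ false ∷ []

-- xs contains x₀ exactly once up to _≈_, all its other entries being Bad.
IsolatedIn : {A : Set} (_≈_ : A → A → Set) (Bad : A → Set) → A → List A → Set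
IsolatedIn {A} _≈_ Bad x₀ xs = (h : A → ℤ) → (∀ {x y} → x ≈ y → h x ≡ h y) →
  (∀ x → Bad x → h x ≡ 0ℤ) → ∑ xs h ≡ h x₀

isolated-Bool : IsolatedIn _≡_ (_≡ true) false bools
isolated-Bool h _ h-bad = trans (cong₂ _+_ (h-bad true refl) (ℤₚ.+-identityʳ (h false))) (ℤₚ.+-identityˡ _)

-- The relation is arbitrary so that the lemma can be iterated: over `bools` it isolates the empty
-- row, and over the rows so listed it isolates the empty arc set.
isolated-allFuns : ∀ {A : Set} {_≈_ : A → A → Set} {Bad : A → Set} {x₀ xs} → (∀ {x} → x ≈ x) →
  IsolatedIn _≈_ Bad x₀ xs → ∀ m →
  IsolatedIn (λ f g → ∀ i → f i ≈ g i) (λ f → ∃ λ i → Bad (f i)) (λ _ → x₀) (allFuns m xs)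
isolated-allFuns ≈-refl iso zero h h-ext h-bad = trans (ℤₚ.+-identityʳ _) (h-ext (λ ()))
isolated-allFuns {A} {_≈_} {x₀ = x₀} {xs} ≈-refl iso (suc m) h h-ext h-bad = begin
  ∑ (allFuns (suc m) xs) h
    ≡⟨ ∑-allFuns m xs h (λ eq → h-ext (λ i → subst (_ ≈_) (eq i) ≈-refl)) ⟩
  ∑ xs (λ x → ∑ (allFuns m xs) (λ f → h (x ◂ f)))
    ≡⟨ iso _ (λ x≈y → ∑-cong (allFuns m xs) (λ f → h-ext (λ { zero → x≈y ; (suc i) → ≈-refl })))
         (λ x bad → ∑-zero (allFuns m xs) (λ f → h-bad (x ◂ f) (zero , bad))) ⟩
  ∑ (allFuns m xs) (λ f → h (x₀ ◂ f))
    ≡⟨ isolated-allFuns ≈-refl iso m _ (λ eq → h-ext (λ { zero → ≈-refl ; (suc i) → eq i }))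
         (λ f (i , bad) → h-bad (x₀ ◂ f) (suc i , bad)) ⟩
  h (x₀ ◂ (λ _ → x₀))
    ≡⟨ h-ext (λ { zero → ≈-refl ; (suc i) → ≈-refl }) ⟩
  h (λ _ → x₀) ∎
  where open ≡-Reasoning

-- The row of the arc i → j, where j = i encodes the empty row.
rowOf : ∀ {n} → Fin n → Fin n → Fin n → Bool
rowOf i j j′ = not (i == j) ∧ (j == j′)

-- Only rows with at most one `true` survive. After a leading `true` all other entries must be
-- `false`; after a leading `false` the induction hypothesis applies.
∑-rows-by-target : ∀ n (h : (Fin n → Bool) → ℤ) → (∀ {f g} → f ≗ g → h f ≡ h g) →
  (∀ f j j′ → j ≢ j′ → f j ≡ true → f j′ ≡ true → h f ≡ 0ℤ) →
  ∑ (allFuns n bools) h ≡ h (λ _ → false) + ∑ (allFin n) (λ j → h (j ==_))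
∑-rows-by-target zero    h h-ext h-two = cong (_+ 0ℤ) (h-ext (λ ()))
∑-rows-by-target (suc n) h h-ext h-two = begin
  ∑ (allFuns (suc n) bools) h
    ≡⟨ ∑-allFuns n bools h h-ext ⟩
  ∑ (allFuns n bools) (λ f → h (true ◂ f)) + (∑ (allFuns n bools) (λ f → h (false ◂ f)) + 0ℤ)
    ≡⟨ cong₂ (λ a b → a + (b + 0ℤ))
         (trans
           (isolated-allFuns refl isolated-Bool n _ (λ eq → h-ext (λ { zero → refl ; (suc i) → eq i }))
             (λ f (i , fi) → h-two (true ◂ f) zero (suc i) (λ ()) refl fi))
           (h-ext {g = zero ==_} (λ { zero → refl ; (suc i) → refl })))
         (trans
           (∑-rows-by-target n (λ f → h (false ◂ f)) (λ eq → h-ext (λ { zero → refl ; (suc i) → eq i }))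
             (λ f j j′ j≢j′ → h-two (false ◂ f) (suc j) (suc j′) (λ { refl → j≢j′ refl })))
           (cong₂ _+_ (h-ext {g = λ _ → false} (λ { zero → refl ; (suc i) → refl }))
             (∑-cong (allFin n) (λ j → h-ext {g = suc j ==_} (λ { zero → refl ; (suc i) → refl }))))) ⟩
  h (zero ==_) + (h (λ _ → false) + ∑ (allFin n) (λ j → h (suc j ==_)) + 0ℤ)
    ≡⟨ lemma (h (zero ==_)) (h (λ _ → false)) _ ⟩
  h (λ _ → false) + (h (zero ==_) + ∑ (allFin n) (λ j → h (suc j ==_)))
    ≡⟨ cong (h (λ _ → false) +_) (sym (∑-suc (λ j → h (j ==_)))) ⟩
  h (λ _ → false) + ∑ (allFin (suc n)) (λ j → h (j ==_)) ∎
  where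
  open ≡-Reasoning
  lemma : ∀ a b c → a + (b + c + 0ℤ) ≡ b + (a + c)
  lemma = solve-∀

-- The row with its only `true` at `i` would be a loop and contributes 0, so its place in the sum is
-- free to carry the empty row. Rows are then indexed by vertices, like the letters of a word.
∑-rows-rowOf : ∀ {n} (i : Fin n) (h : (Fin n → Bool) → ℤ) → (∀ {f g} → f ≗ g → h f ≡ h g) →
  (∀ f j j′ → j ≢ j′ → f j ≡ true → f j′ ≡ true → h f ≡ 0ℤ) →
  (∀ f → f i ≡ true → h f ≡ 0ℤ) →
  ∑ (allFuns n bools) h ≡ ∑ (allFin n) (λ j → h (rowOf i j))
∑-rows-rowOf {n} i h h-ext h-two h-loop = begin
  ∑ (allFuns n bools) h
    ≡⟨ ∑-rows-by-target n h h-ext h-two ⟩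
  h (λ _ → false) + ∑ (allFin n) (λ j → h (j ==_))
    ≡⟨ cong (_+ ∑ (allFin n) (λ j → h (j ==_))) (sym (∑-δ i (λ _ → h (λ _ → false)))) ⟩
  ∑ (allFin n) (λ j → ⟦ i == j ⟧ * h (λ _ → false)) + ∑ (allFin n) (λ j → h (j ==_))
    ≡⟨ sym (∑-+ (allFin n) _ _) ⟩
  ∑ (allFin n) (λ j → ⟦ i == j ⟧ * h (λ _ → false) + h (j ==_))
    ≡⟨ ∑-cong (allFin n) (λ j → term j) ⟩
  ∑ (allFin n) (λ j → h (rowOf i j)) ∎
  where
  open ≡-Reasoning
  term : ∀ j → ⟦ i == j ⟧ * h (λ _ → false) + h (j ==_) ≡ h (rowOf i j)
  term j with i ≟ j
  ... | yes refl = trans (cong₂ _+_ (ℤₚ.*-identityˡ (h (λ _ → false))) (h-loop (i ==_) (==-refl i))) (ℤₚ.+-identityʳ (h (λ _ → false)))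
  ... | no _     = ℤₚ.+-identityˡ _

-- The induction removes rows but keeps all columns, so the column `ρ i` that would be the loop of
-- row `i` has to be a parameter.
∑-arcSets : ∀ {n} m (ρ : Fin m → Fin n) (g : (Fin m → Fin n → Bool) → ℤ) →
  (∀ {E E′} → (∀ i → E i ≗ E′ i) → g E ≡ g E′) →
  (∀ E i j j′ → j ≢ j′ → E i j ≡ true → E i j′ ≡ true → g E ≡ 0ℤ) →
  (∀ E i → E i (ρ i) ≡ true → g E ≡ 0ℤ) →
  ∑ (allFuns m (allFuns n bools)) g ≡ ∑ (allFuns m (allFin n)) (λ F → g (λ i → rowOf (ρ i) (F i)))
∑-arcSets zero    ρ g g-ext g-two g-loop = cong (_+ 0ℤ) (g-ext (λ ()))
∑-arcSets {n} (suc m) ρ g g-ext g-two g-loop = begin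
  ∑ (allFuns (suc m) R) g
    ≡⟨ ∑-allFuns m R g (λ eq → g-ext (λ i j → cong (λ f → f j) (eq i))) ⟩
  ∑ R (λ r → ∑ (allFuns m R) (λ E → g (r ◂ E)))
    ≡⟨ ∑-rows-rowOf (ρ zero) _
         (λ eq → ∑-cong (allFuns m R) (λ E → g-ext (λ { zero → eq ; (suc i) _ → refl })))
         (λ r j j′ j≢j′ rj rj′ → ∑-zero (allFuns m R) (λ E → g-two (r ◂ E) zero j j′ j≢j′ rj rj′))
         (λ r ri → ∑-zero (allFuns m R) (λ E → g-loop (r ◂ E) zero ri)) ⟩
  ∑ (allFin n) (λ j → ∑ (allFuns m R) (λ E → g (rowOf (ρ zero) j ◂ E)))
    ≡⟨ ∑-cong (allFin n) (λ j → ∑-arcSets m (ρ ∘ suc) (λ E → g (rowOf (ρ zero) j ◂ E))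
         (λ eq → g-ext (λ { zero _ → refl ; (suc i) → eq i }))
         (λ E i → g-two (rowOf (ρ zero) j ◂ E) (suc i))
         (λ E i → g-loop (rowOf (ρ zero) j ◂ E) (suc i))) ⟩
  ∑ (allFin n) (λ j → ∑ (allFuns m (allFin n)) (λ F → g (rowOf (ρ zero) j ◂ λ i → rowOf (ρ (suc i)) (F i))))
    ≡⟨ ∑-cong (allFin n) (λ j → ∑-cong (allFuns m (allFin n)) (λ F →
         g-ext (λ { zero _ → refl ; (suc i) _ → refl }))) ⟩
  ∑ (allFin n) (λ j → ∑ (allFuns m (allFin n)) (λ F → g (λ i → rowOf (ρ i) ((j ◂ F) i))))
    ≡⟨ sym (∑-allFuns m (allFin n) _ (λ eq → g-ext (λ i j → cong (λ k → rowOf (ρ i) k j) (eq i)))) ⟩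
  ∑ (allFuns (suc m) (allFin n)) (λ F → g (λ i → rowOf (ρ i) (F i))) ∎
  where
  open ≡-Reasoning
  R = allFuns n bools

-- Determinants and permanents

-- A polynomial is represented by its coefficient function; shift true is multiplication by z.
shift : Bool → (ℕ → ℤ) → ℕ → ℤ
shift false g k       = g k
shift true  g zero    = 0ℤ
shift true  g (suc k) = g k

shift-cong : ∀ b {g g′} → g ≗ g′ → shift b g ≗ shift b g′
shift-cong false eq k       = eq k
shift-cong true  eq zero    = refl
shift-cong true  eq (suc k) = eq k

shift-scale : ∀ b a {g g′} → (∀ k → g k ≡ a * g′ k) → ∀ k → shift b g k ≡ a * shift b g′ k
shift-scale false a eq k       = eq k
shift-scale true  a eq zero    = sym (ℤₚ.*-zeroʳ a)
shift-scale true  a eq (suc k) = eq k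

-- The sum over all splittings cs = a ++ c ∷ t of ε ^ length a · e c · z^[b c] · G (a ++ t).
expand : {C : Set} → ℤ → (C → ℤ) → (C → Bool) → (List C → ℕ → ℤ) → List C → ℕ → ℤ
expand ε e b G []       k = 0ℤ
expand ε e b G (c ∷ cs) k = e c * shift (b c) (G cs) k + ε * expand ε e b (G ∘ (c ∷_)) cs k

-- The determinant (ε = -1) or permanent (ε = 1) of the matrix with entries
-- e r c · z^[b r c], by expansion along the rows.
expansion : {R C : Set} → ℤ → (R → C → ℤ) → (R → C → Bool) → List R → List C → ℕ → ℤ
expansion ε e b []       []       k = coeff [ 1ℤ ] k
expansion ε e b []       (_ ∷ _)  k = 0ℤ
expansion ε e b (r ∷ rs) cs       k = expand ε (e r) (b r) (expansion ε e b rs) cs k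

^-square : ∀ ε → ε * ε ≡ 1ℤ → ∀ m → ε ^ m * ε ^ m ≡ 1ℤ
^-square ε ε² zero    = refl
^-square ε ε² (suc m) = trans (lemma ε (ε ^ m)) (cong₂ _*_ ε² (^-square ε ε² m))
  where
  lemma : ∀ a b → a * b * (a * b) ≡ a * a * (b * b)
  lemma = solve-∀

module _ {C : Set} (ε : ℤ) (ε² : ε * ε ≡ 1ℤ) where

  Alternating : (List C → ℕ → ℤ) → Set
  Alternating G = ∀ a x y t k → G (a ++ x ∷ y ∷ t) k ≡ ε * G (a ++ y ∷ x ∷ t) k

  expand-scale : ∀ (e : C → ℤ) b {G G′} → (∀ cs k → G cs k ≡ ε * G′ cs k) →
                 ∀ cs k → expand ε e b G cs k ≡ ε * expand ε e b G′ cs k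
  expand-scale e b eq []       k = sym (ℤₚ.*-zeroʳ ε)
  expand-scale e b {G} {G′} eq (c ∷ cs) k = trans
    (cong₂ (λ u v → e c * u + ε * v) (shift-scale (b c) ε (eq cs) k)
      (expand-scale e b {G ∘ (c ∷_)} {G′ ∘ (c ∷_)} (eq ∘ (c ∷_)) cs k))
    (lemma ε (e c) _ _)
    where
    lemma : ∀ ε a u v → a * (ε * u) + ε * (ε * v) ≡ ε * (a * u + ε * v)
    lemma = solve-∀

  -- A term choosing neither of the two columns changes by `ε` because `G` does. In a term choosing
  -- one of them that column moves by one position, which changes the power of `ε` in front by one;
  -- `ε²` makes both directions of the move agree.
  expand-alternating : ∀ e b {G} → Alternating G → Alternating (expand ε e b G)
  expand-alternating e b {G} alt [] x y t k = begin
    X + ε * (Y + ε * expand ε e b (λ cs → G (x ∷ y ∷ cs)) t k)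
      ≡⟨ cong (λ u → X + ε * (Y + ε * u)) (expand-scale e b {λ cs → G (x ∷ y ∷ cs)} {λ cs → G (y ∷ x ∷ cs)} (alt [] x y) t k) ⟩
    X + ε * (Y + ε * (ε * Z))
      ≡⟨ cong (_+ ε * (Y + ε * (ε * Z))) (sym (trans (cong (_* X) ε²) (ℤₚ.*-identityˡ X))) ⟩
    ε * ε * X + ε * (Y + ε * (ε * Z))
      ≡⟨ lemma ε X Y Z ⟩
    ε * (Y + ε * (X + ε * Z)) ∎
    where
    open ≡-Reasoning
    X = e x * shift (b x) (G (y ∷ t)) k
    Y = e y * shift (b y) (G (x ∷ t)) k
    Z = expand ε e b (λ cs → G (y ∷ x ∷ cs)) t k
    lemma : ∀ ε x y z → ε * ε * x + ε * (y + ε * (ε * z)) ≡ ε * (y + ε * (x + ε * z))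
    lemma = solve-∀
  expand-alternating e b {G} alt (c ∷ a) x y t k = trans
    (cong₂ (λ u v → e c * u + ε * v) (shift-scale (b c) ε (alt a x y t) k)
      (expand-alternating e b {G ∘ (c ∷_)} (alt ∘ (c ∷_)) a x y t k))
    (lemma ε (e c) _ _)
    where
    lemma : ∀ ε a u v → a * (ε * u) + ε * (ε * v) ≡ ε * (a * u + ε * v)
    lemma = solve-∀

  move-right : ∀ {G} → Alternating G → ∀ c a t k → G (c ∷ a ++ t) k ≡ ε ^ length a * G (a ++ c ∷ t) k
  move-right alt c []      t k = sym (ℤₚ.*-identityˡ _)
  move-right {G} alt c (x ∷ a) t k = begin
    G (c ∷ x ∷ a ++ t) k                         ≡⟨ alt [] c x (a ++ t) k ⟩
    ε * G (x ∷ c ∷ a ++ t) k                     ≡⟨ cong (ε *_) (move-right {G ∘ (x ∷_)} (alt ∘ (x ∷_)) c a t k) ⟩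
    ε * (ε ^ length a * G (x ∷ a ++ c ∷ t) k)    ≡⟨ sym (ℤₚ.*-assoc ε _ _) ⟩
    ε * ε ^ length a * G (x ∷ a ++ c ∷ t) k      ∎
    where open ≡-Reasoning

  expansion-alternating : ∀ {R : Set} (e : R → C → ℤ) b rs → Alternating (expansion ε e b rs)
  expansion-alternating e b []       []      x y t k = sym (ℤₚ.*-zeroʳ ε)
  expansion-alternating e b []       (_ ∷ _) x y t k = sym (ℤₚ.*-zeroʳ ε)
  expansion-alternating e b (r ∷ rs) = expand-alternating (e r) (b r) (expansion-alternating e b rs)

  -- The hypothesis exposes the whole splitting of `vs`, because its proof must rebuild the list
  -- with a merged vertex in the place of `v`.
  expand-compare : ∀ {V : Set} (f : V → C) τ (e e′ : C → ℤ) b vs {G G′} →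
    (∀ a v t → vs ≡ a ++ v ∷ t → ∀ k →
      ε ^ length a * (e (f v) * shift (b (f v)) (G (map f a ++ map f t)) k)
        ≡ τ * (e′ (f v) * shift (b (f v)) (G′ (map f a ++ map f t)) k)) →
    ∀ k → expand ε e b G (map f vs) k ≡ τ * expand 1ℤ e′ b G′ (map f vs) k
  expand-compare f τ e e′ b [] eq k = sym (ℤₚ.*-zeroʳ τ)
  expand-compare f τ e e′ b (v ∷ vs) {G} {G′} eq k = begin
    X + ε * Y
      ≡⟨ cong₂ (λ x y → x + ε * y) (trans (sym (ℤₚ.*-identityˡ X)) (eq [] v vs refl k))
           (expand-compare f (ε * τ) e e′ b vs {G ∘ (f v ∷_)} {G′ ∘ (f v ∷_)} tail-eq k) ⟩
    τ * X′ + ε * (ε * τ * Y′)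
      ≡⟨ lemma₁ ε τ X′ Y′ ⟩
    τ * X′ + ε * ε * (τ * Y′)
      ≡⟨ cong (λ u → τ * X′ + u * (τ * Y′)) ε² ⟩
    τ * X′ + 1ℤ * (τ * Y′)
      ≡⟨ lemma₂ τ X′ Y′ ⟩
    τ * (X′ + 1ℤ * Y′) ∎
    where
    open ≡-Reasoning
    X  = e (f v) * shift (b (f v)) (G (map f vs)) k
    Y  = expand ε e b (G ∘ (f v ∷_)) (map f vs) k
    X′ = e′ (f v) * shift (b (f v)) (G′ (map f vs)) k
    Y′ = expand 1ℤ e′ b (G′ ∘ (f v ∷_)) (map f vs) k
    lemma₁ : ∀ ε τ x y → τ * x + ε * (ε * τ * y) ≡ τ * x + ε * ε * (τ * y)
    lemma₁ = solve-∀
    lemma₂ : ∀ τ x y → τ * x + 1ℤ * (τ * y) ≡ τ * (x + 1ℤ * y)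
    lemma₂ = solve-∀
    tail-eq : ∀ a w t → vs ≡ a ++ w ∷ t → ∀ k →
      ε ^ length a * (e (f w) * shift (b (f w)) (G (f v ∷ map f a ++ map f t)) k)
        ≡ ε * τ * (e′ (f w) * shift (b (f w)) (G′ (f v ∷ map f a ++ map f t)) k)
    tail-eq a w t vs≡ k = begin
      ε ^ length a * U              ≡⟨ sym (ℤₚ.*-identityˡ _) ⟩
      1ℤ * (ε ^ length a * U)       ≡⟨ cong (_* (ε ^ length a * U)) (sym ε²) ⟩
      ε * ε * (ε ^ length a * U)    ≡⟨ lemma₃ ε (ε ^ length a) U ⟩
      ε * (ε * ε ^ length a * U)    ≡⟨ cong (ε *_) (eq (v ∷ a) w t (cong (v ∷_) vs≡) k) ⟩
      ε * (τ * U′)                  ≡⟨ sym (ℤₚ.*-assoc ε τ U′) ⟩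
      ε * τ * U′                    ∎
      where
      U  = e (f w) * shift (b (f w)) (G (f v ∷ map f a ++ map f t)) k
      U′ = e′ (f w) * shift (b (f w)) (G′ (f v ∷ map f a ++ map f t)) k
      lemma₃ : ∀ ε p u → ε * ε * (p * u) ≡ ε * (ε * p * u)
      lemma₃ = solve-∀

-- Contraction

-- A vertex whose outgoing arcs are read off the row `row` of the matrix, and whose
-- incoming arcs are read off the column `col`, multiplied by `sgn`.
record Site (R C : Set) : Set where
  constructor site
  field
    row : R
    col : C
    sgn : ℤ
open Site

IsUnit : ℤ → Set
IsUnit x = x * x ≡ 1ℤ

*-isUnit : ∀ x y → IsUnit x → IsUnit y → IsUnit (x * y)
*-isUnit x y x² y² = trans (lemma x y) (cong₂ _*_ x² y²)
  where
  lemma : ∀ x y → x * y * (x * y) ≡ x * x * (y * y)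
  lemma = solve-∀

module _ {R C : Set} (s : R → C → ℤ) where

  walk : R → List (Site R C) → ℤ
  walk r []       = 1ℤ
  walk r (v ∷ vs) = s r (col v) * sgn v * walk (row v) vs

  lastRow : R → List (Site R C) → R
  lastRow r []       = r
  lastRow r (v ∷ vs) = lastRow (row v) vs

  -- The closing arc is taken first, which makes a cycle a walk. The value at the empty list only
  -- lets the empty selection of vertices pass `AllCyclesNegative`.
  cycleProduct : List (Site R C) → ℤ
  cycleProduct []       = -1ℤ
  cycleProduct (v ∷ vs) = walk (lastRow (row v) vs) (v ∷ vs)

  -- A vanishing product means that ys is not a cycle.
  AllCyclesNegative : List (Site R C) → Set
  AllCyclesNegative vs = ∀ ys zs → ys ++ zs ↭ vs → cycleProduct ys ≡ 0ℤ ⊎ cycleProduct ys ≡ -1ℤ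

  -- Passing through the merged vertex has the same sign as passing through `u` and then `v`, since
  -- the sign of the arc between them is stored.
  contract : Site R C → Site R C → Site R C
  contract u v = site (row v) (col u) (sgn u * (s (row u) (col v) * sgn v))

  walk-contract : ∀ u v r a t → walk r (a ++ contract u v ∷ t) ≡ walk r (a ++ u ∷ v ∷ t)
  walk-contract u v r []      t = lemma (s r (col u)) (sgn u) (s (row u) (col v) * sgn v) _
    where
    lemma : ∀ x y z w → x * (y * z) * w ≡ x * y * (z * w)
    lemma = solve-∀
  walk-contract u v r (x ∷ a) t = cong (s r (col x) * sgn x *_) (walk-contract u v (row x) a t)

  lastRow-contract : ∀ u v r a t → lastRow r (a ++ contract u v ∷ t) ≡ lastRow r (a ++ u ∷ v ∷ t)
  lastRow-contract u v r []      t = refl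
  lastRow-contract u v r (x ∷ a) t = lastRow-contract u v (row x) a t

  cycleProduct-contract : ∀ u v a t → cycleProduct (a ++ contract u v ∷ t) ≡ cycleProduct (a ++ u ∷ v ∷ t)
  cycleProduct-contract u v []      t = walk-contract u v _ [] t
  cycleProduct-contract u v (x ∷ a) t = trans
    (cong (λ r → walk r (x ∷ a ++ contract u v ∷ t)) (lastRow-contract u v (row x) a t))
    (walk-contract u v _ (x ∷ a) t)

  negative-tail : ∀ {v vs} → AllCyclesNegative (v ∷ vs) → AllCyclesNegative vs
  negative-tail {v} neg ys zs ys++zs↭vs =
    neg ys (v ∷ zs) (↭-trans (↭-shift v ys zs) (prep v ys++zs↭vs))

  uncontract : ∀ u v a t as bs → as ++ contract u v ∷ bs ↭ a ++ contract u v ∷ t → as ++ u ∷ v ∷ bs ↭ u ∷ a ++ v ∷ t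
  uncontract u v a t as bs perm = ↭-trans (↭-shift u as (v ∷ bs)) (prep u (↭-trans (↭-shift v as bs)
    (↭-trans (prep v (drop-mid as a perm)) (↭-sym (↭-shift v a t)))))

  negative-contract : ∀ u v a t → AllCyclesNegative (u ∷ a ++ v ∷ t) → AllCyclesNegative (a ++ contract u v ∷ t)
  negative-contract u v a t neg ys zs perm with ∈-++⁻ ys (∈-resp-↭ (↭-sym perm) (∈-insert a))
  ... | inj₁ w∈ys with as , bs , refl ← ∈-∃++ w∈ys =
    subst (λ x → x ≡ 0ℤ ⊎ x ≡ -1ℤ) (sym (cycleProduct-contract u v as bs))
      (neg (as ++ u ∷ v ∷ bs) zs (subst (_↭ u ∷ a ++ v ∷ t) (sym (Listₚ.++-assoc as (u ∷ v ∷ bs) zs))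
        (uncontract u v a t as (bs ++ zs) (subst (_↭ _) (Listₚ.++-assoc as (contract u v ∷ bs) zs) perm))))
  ... | inj₂ w∈zs with as , bs , refl ← ∈-∃++ w∈zs =
      neg ys (as ++ u ∷ v ∷ bs) (subst (_↭ u ∷ a ++ v ∷ t) (Listₚ.++-assoc ys as (u ∷ v ∷ bs))
        (uncontract u v a t (ys ++ as) bs (subst (_↭ _) (sym (Listₚ.++-assoc ys as (contract u v ∷ bs))) perm)))

  signs : List (Site R C) → ℤ
  signs = foldr (λ v x → sgn v * x) 1ℤ

  signs-++ : ∀ a v t → signs (a ++ v ∷ t) ≡ sgn v * (signs a * signs t)
  signs-++ []      v t = cong (sgn v *_) (sym (ℤₚ.*-identityˡ (signs t)))
  signs-++ (x ∷ a) v t = trans (cong (sgn x *_) (signs-++ a v t)) (lemma (sgn x) (sgn v) (signs a) (signs t))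
    where
    lemma : ∀ x y z w → x * (y * (z * w)) ≡ y * (x * z * w)
    lemma = solve-∀

  module _ (b : R → C → Bool) (p : R → C → ℤ) (supported : ∀ r c → p r c ≡ 0ℤ ⊎ IsUnit (s r c)) where

    negEntry : R → C → ℤ
    negEntry r c = - (s r c * p r c)

    -- Around a negative cycle the product of the entries of `s` is minus the product of the stored
    -- signs, which explains the factor `signs vs`. The induction is on the length because the
    -- contracted list is shorter without being a part of `vs`.
    det≡perm : ∀ m vs → length vs ≡ m → AllCyclesNegative vs → All (IsUnit ∘ sgn) vs → ∀ k →
      expansion -1ℤ negEntry b (map row vs) (map col vs) k ≡ signs vs * expansion 1ℤ p b (map row vs) (map col vs) k
    det≡perm zero    [] _ _ _ k = sym (ℤₚ.*-identityˡ _)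
    det≡perm (suc m) (u ∷ vs) len neg (u² ∷ units) k = begin
      negEntry r₀ c₀ * shiftX + -1ℤ * expand -1ℤ (negEntry r₀) (b r₀) (D ∘ (c₀ ∷_)) (map col vs) k
        ≡⟨ cong₂ (λ x y → negEntry r₀ c₀ * x + -1ℤ * y)
             (shift-scale (b r₀ c₀) (signs vs) (det≡perm m vs (ℕₚ.suc-injective len) (negative-tail neg) units) k)
             -- The minus sign of the ratio comes from `negEntry`. It cancels against the -1 in
             -- front of the sum, which is the cost of skipping column `c₀`.
             (expand-compare -1ℤ refl col (- (sgn u * signs vs)) (negEntry r₀) (p r₀) (b r₀) vs
               {D ∘ (c₀ ∷_)} {Q ∘ (c₀ ∷_)} offLoop k) ⟩
      negEntry r₀ c₀ * (signs vs * shiftY) + -1ℤ * (- (sgn u * signs vs) * Z)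
        ≡⟨ lemma₁ (negEntry r₀ c₀) (signs vs) shiftY (sgn u) Z ⟩
      negEntry r₀ c₀ * (signs vs * shiftY) + sgn u * signs vs * Z
        ≡⟨ cong (λ x → x * (signs vs * shiftY) + sgn u * signs vs * Z) loop ⟩
      sgn u * p r₀ c₀ * (signs vs * shiftY) + sgn u * signs vs * Z
        ≡⟨ lemma₂ (sgn u) (p r₀ c₀) (signs vs) shiftY Z ⟩
      sgn u * signs vs * (p r₀ c₀ * shiftY + 1ℤ * Z) ∎
      where
      open ≡-Reasoning
      r₀ = row u
      c₀ = col u
      D = expansion -1ℤ negEntry b (map row vs)
      Q = expansion 1ℤ p b (map row vs)
      shiftX = shift (b r₀ c₀) (D (map col vs)) k
      shiftY = shift (b r₀ c₀) (Q (map col vs)) k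
      Z = expand 1ℤ (p r₀) (b r₀) (Q ∘ (c₀ ∷_)) (map col vs) k

      lemma₁ : ∀ n x y w z → n * (x * y) + -1ℤ * (- (w * x) * z) ≡ n * (x * y) + w * x * z
      lemma₁ = solve-∀
      lemma₂ : ∀ w e x y z → w * e * (x * y) + w * x * z ≡ w * x * (e * y + 1ℤ * z)
      lemma₂ = solve-∀

      loop : negEntry r₀ c₀ ≡ sgn u * p r₀ c₀
      loop with supported r₀ c₀ | neg [ u ] vs ↭-refl
      ... | inj₁ p≡0 | _ rewrite p≡0 = trans (cong -_ (ℤₚ.*-zeroʳ (s r₀ c₀))) (sym (ℤₚ.*-zeroʳ (sgn u)))
      -- Both factors of the loop at `u` are units, so its product cannot vanish.
      ... | inj₂ s² | inj₁ zero-product = ⊥-elim (0≢1 (begin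
        0ℤ                                            ≡⟨ cong (_* (s r₀ c₀ * sgn u)) (trans (sym zero-product) (ℤₚ.*-identityʳ (s r₀ c₀ * sgn u))) ⟩
        s r₀ c₀ * sgn u * (s r₀ c₀ * sgn u)           ≡⟨ *-isUnit (s r₀ c₀) (sgn u) s² u² ⟩
        1ℤ                                            ∎))
        where
        0≢1 : ¬ 0ℤ ≡ 1ℤ
        0≢1 ()
      ... | inj₂ s² | inj₂ negative = begin
        - (s r₀ c₀ * p r₀ c₀)                         ≡⟨ cong (λ x → - (x * p r₀ c₀)) (sym (ℤₚ.*-identityʳ (s r₀ c₀))) ⟩
        - (s r₀ c₀ * 1ℤ * p r₀ c₀)                    ≡⟨ cong (λ x → - (s r₀ c₀ * x * p r₀ c₀)) (sym u²) ⟩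
        - (s r₀ c₀ * (sgn u * sgn u) * p r₀ c₀)       ≡⟨ lemma (s r₀ c₀) (sgn u) (p r₀ c₀) ⟩
        - (s r₀ c₀ * sgn u * 1ℤ) * (sgn u * p r₀ c₀)  ≡⟨ cong (λ x → - x * (sgn u * p r₀ c₀)) negative ⟩
        1ℤ * (sgn u * p r₀ c₀)                        ≡⟨ ℤₚ.*-identityˡ _ ⟩
        sgn u * p r₀ c₀                               ∎
        where
        lemma : ∀ x y z → - (x * (y * y) * z) ≡ - (x * y * 1ℤ) * (y * z)
        lemma = solve-∀

      offLoop : ∀ a v t → vs ≡ a ++ v ∷ t → ∀ k →
        -1ℤ ^ length a * (negEntry r₀ (col v) * shift (b r₀ (col v)) (D (c₀ ∷ map col a ++ map col t)) k)
          ≡ - (sgn u * signs vs) * (p r₀ (col v) * shift (b r₀ (col v)) (Q (c₀ ∷ map col a ++ map col t)) k)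
      offLoop a v t refl k with supported r₀ (col v)
      ... | inj₁ p≡0 rewrite p≡0 = lemma (-1ℤ ^ length a) (s r₀ (col v))
          (shift (b r₀ (col v)) (D (c₀ ∷ map col a ++ map col t)) k) (sgn u * signs vs)
          (shift (b r₀ (col v)) (Q (c₀ ∷ map col a ++ map col t)) k)
        where
        lemma : ∀ x y z w t → x * (- (y * 0ℤ) * z) ≡ - w * (0ℤ * t)
        lemma = solve-∀
      ... | inj₂ s² = begin
        σ * (- (q * e) * shift (b r₀ (col v)) (D (c₀ ∷ map col a ++ map col t)) k)
          ≡⟨ cong (λ x → σ * (- (q * e) * x)) (shift-scale (b r₀ (col v)) (σ * signs vs′) D≡Q k) ⟩
        σ * (- (q * e) * (σ * signs vs′ * Y))
          ≡⟨ cong (λ x → σ * (- (q * e) * (σ * x * Y))) (signs-++ a (contract u v) t) ⟩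
        σ * (- (q * e) * (σ * (sgn u * (q * sgn v) * (signs a * signs t)) * Y))
          ≡⟨ lemma σ q e (sgn u) (sgn v) (signs a) (signs t) Y ⟩
        σ * σ * (q * q) * (- (sgn u * (sgn v * (signs a * signs t))) * (e * Y))
          -- Each sign occurs twice: `σ` from the position of `v` and from moving `c₀` there, `q`
          -- from the matrix entry and from the sign stored in the merged vertex.
          ≡⟨ cong₂ (λ x y → x * y * (- (sgn u * (sgn v * (signs a * signs t))) * (e * Y))) (^-square -1ℤ refl (length a)) s² ⟩
        1ℤ * (- (sgn u * (sgn v * (signs a * signs t))) * (e * Y))
          ≡⟨ ℤₚ.*-identityˡ _ ⟩
        - (sgn u * (sgn v * (signs a * signs t))) * (e * Y)
          ≡⟨ cong (λ x → - (sgn u * x) * (e * Y)) (sym (signs-++ a v t)) ⟩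
        - (sgn u * signs vs) * (e * Y) ∎
        where
        σ = -1ℤ ^ length a
        q = s r₀ (col v)
        e = p r₀ (col v)
        vs′ = a ++ contract u v ∷ t
        Y = shift (b r₀ (col v)) (Q (c₀ ∷ map col a ++ map col t)) k

        lemma : ∀ σ q e x y A T Y → σ * (- (q * e) * (σ * (x * (q * y) * (A * T)) * Y)) ≡ σ * σ * (q * q) * (- (x * (y * (A * T))) * (e * Y))
        lemma = solve-∀

        -- The merged vertex keeps the row of `v`, so the rows stay in order; only the column `c₀`
        -- has to be moved, to the place vacated by the column of `v`.
        rows : map row vs ≡ map row vs′
        rows = trans (Listₚ.map-++ row a _) (sym (Listₚ.map-++ row a _))

        cols : map col a ++ c₀ ∷ map col t ≡ map col vs′
        cols = sym (Listₚ.map-++ col a _)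

        move : ∀ ε (ε² : ε * ε ≡ 1ℤ) e k →
          expansion ε e b (map row vs) (c₀ ∷ map col a ++ map col t) k ≡
          ε ^ length a * expansion ε e b (map row vs′) (map col vs′) k
        move ε ε² e k = begin
          expansion ε e b (map row vs) (c₀ ∷ map col a ++ map col t) k
            ≡⟨ move-right ε ε² {expansion ε e b (map row vs)} (expansion-alternating ε ε² e b (map row vs)) c₀ (map col a) (map col t) k ⟩
          ε ^ length (map col a) * expansion ε e b (map row vs) (map col a ++ c₀ ∷ map col t) k
            ≡⟨ cong₂ _*_ (cong (ε ^_) (Listₚ.length-map col a)) (cong₂ (λ x y → expansion ε e b x y k) rows cols) ⟩
          ε ^ length a * expansion ε e b (map row vs′) (map col vs′) k ∎

        len′ : length vs′ ≡ m
        len′ = trans (Listₚ.length-++ a) (trans (sym (Listₚ.length-++ a)) (ℕₚ.suc-injective len))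

        units′ : All (IsUnit ∘ sgn) vs′
        units′ with Allₚ.++⁻ a units
        ... | as , v² ∷ ts = Allₚ.++⁺ as (*-isUnit (sgn u) (q * sgn v) u² (*-isUnit q (sgn v) s² v²) ∷ ts)

        D≡Q : ∀ k → D (c₀ ∷ map col a ++ map col t) k ≡ σ * signs vs′ * Q (c₀ ∷ map col a ++ map col t) k
        D≡Q k = begin
          D (c₀ ∷ map col a ++ map col t) k
            ≡⟨ move -1ℤ refl negEntry k ⟩
          σ * expansion -1ℤ negEntry b (map row vs′) (map col vs′) k
            ≡⟨ cong (σ *_) (det≡perm m vs′ len′ (negative-contract u v a t neg) units′ k) ⟩
          σ * (signs vs′ * Q′)
            ≡⟨ sym (ℤₚ.*-assoc σ (signs vs′) Q′) ⟩
          σ * signs vs′ * Q′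
            ≡⟨ cong (σ * signs vs′ *_) (sym (trans (move 1ℤ refl p k) (trans (cong (_* Q′) (ℤₚ.^-zeroˡ (length a))) (ℤₚ.*-identityˡ Q′)))) ⟩
          σ * signs vs′ * Q (c₀ ∷ map col a ++ map col t) k ∎
          where
          Q′ = expansion 1ℤ p b (map row vs′) (map col vs′) k

-- The characteristic polynomial

altSign-suc : ∀ m → altSign (suc m) ≡ -1ℤ * altSign m
altSign-suc zero          = refl
altSign-suc (suc zero)    = refl
altSign-suc (suc (suc m)) = altSign-suc m

coeff-+P : ∀ p q k → coeff (p +P q) k ≡ coeff p k + coeff q k
coeff-+P []      q       k       = sym (ℤₚ.+-identityˡ (coeff q k))
coeff-+P (a ∷ p) []      k       = sym (ℤₚ.+-identityʳ (coeff (a ∷ p) k))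
coeff-+P (a ∷ p) (b ∷ q) zero    = refl
coeff-+P (a ∷ p) (b ∷ q) (suc k) = coeff-+P p q k

coeff-scaleP : ∀ a p k → coeff (scaleP a p) k ≡ a * coeff p k
coeff-scaleP a []      k       = sym (ℤₚ.*-zeroʳ a)
coeff-scaleP a (b ∷ p) zero    = refl
coeff-scaleP a (b ∷ p) (suc k) = coeff-scaleP a p k

coeff-sumP : ∀ {A : Set} (f : A → Poly) xs k → coeff (sumP f xs) k ≡ ∑ xs (λ x → coeff (f x) k)
coeff-sumP f []       k = refl
coeff-sumP f (x ∷ xs) k = trans (coeff-+P (f x) _ k) (cong (coeff (f x) k +_) (coeff-sumP f xs k))

coeff-[0] : ∀ k → coeff [ 0ℤ ] k ≡ 0ℤ
coeff-[0] zero    = refl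
coeff-[0] (suc k) = refl

coeff-constant : ∀ a q k → coeff ([ a ] *P q) k ≡ a * coeff q k
coeff-constant a q k = begin
  coeff (scaleP a q +P [ 0ℤ ]) k           ≡⟨ coeff-+P (scaleP a q) [ 0ℤ ] k ⟩
  coeff (scaleP a q) k + coeff [ 0ℤ ] k    ≡⟨ cong₂ _+_ (coeff-scaleP a q k) (coeff-[0] k) ⟩
  a * coeff q k + 0ℤ                       ≡⟨ ℤₚ.+-identityʳ _ ⟩
  a * coeff q k                            ∎
  where open ≡-Reasoning

coeff-z : ∀ q k → coeff ((0ℤ ∷ [ 1ℤ ]) *P q) k ≡ shift true (coeff q) k
coeff-z q k = begin
  coeff (scaleP 0ℤ q +P (0ℤ ∷ ([ 1ℤ ] *P q))) k
    ≡⟨ coeff-+P (scaleP 0ℤ q) (0ℤ ∷ ([ 1ℤ ] *P q)) k ⟩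
  coeff (scaleP 0ℤ q) k + coeff (0ℤ ∷ ([ 1ℤ ] *P q)) k
    ≡⟨ cong₂ _+_ (coeff-scaleP 0ℤ q k) (shifted k) ⟩
  0ℤ + shift true (coeff q) k
    ≡⟨ ℤₚ.+-identityˡ _ ⟩
  shift true (coeff q) k ∎
  where
  open ≡-Reasoning
  shifted : ∀ k → coeff (0ℤ ∷ ([ 1ℤ ] *P q)) k ≡ shift true (coeff q) k
  shifted zero    = refl
  shifted (suc k) = trans (coeff-constant 1ℤ q k) (ℤₚ.*-identityˡ _)

-- `punchIn (suc j)` fixes 0, so a skipped first column stays in front of every later minor. The
-- remaining sum therefore has the same form with `G ∘ (γ zero ∷_)`, and `rest` calls the lemma
-- back.
expand-tabulate : ∀ {C : Set} e b (G : List C → ℕ → ℤ) m (γ : Fin (suc m) → C) k →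
  ∑ (allFin (suc m)) (λ j → altSign (toℕ j) * (e (γ j) * shift (b (γ j)) (G (tabulate (γ ∘ punchIn j))) k))
    ≡ expand -1ℤ e b G (tabulate γ) k
expand-tabulate e b G m γ k = trans (∑-suc term) (cong₂ _+_ (ℤₚ.*-identityˡ (e (γ zero) * shift (b (γ zero)) (G (tabulate (γ ∘ suc))) k)) (rest m γ))
  where
  term = λ j → altSign (toℕ j) * (e (γ j) * shift (b (γ j)) (G (tabulate (γ ∘ punchIn j))) k)
  rest : ∀ m (γ : Fin (suc m) → _) →
    ∑ (allFin m) (λ j → altSign (suc (toℕ j)) * (e (γ (suc j)) * shift (b (γ (suc j))) (G (tabulate (γ ∘ punchIn (suc j)))) k))
      ≡ -1ℤ * expand -1ℤ e b (G ∘ (γ zero ∷_)) (tabulate (γ ∘ suc)) k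
  rest zero    γ = refl
  rest (suc m) γ = begin
    ∑ (allFin (suc m)) (λ j → altSign (suc (toℕ j)) * t j)
      ≡⟨ ∑-cong (allFin (suc m)) (λ j → trans (cong (_* t j) (altSign-suc (toℕ j))) (ℤₚ.*-assoc -1ℤ (altSign (toℕ j)) (t j))) ⟩
    ∑ (allFin (suc m)) (λ j → -1ℤ * (altSign (toℕ j) * t j))
      ≡⟨ ∑-*ˡ (allFin (suc m)) -1ℤ (λ j → altSign (toℕ j) * t j) ⟩
    -1ℤ * ∑ (allFin (suc m)) (λ j → altSign (toℕ j) * t j)
      ≡⟨ cong (-1ℤ *_) (expand-tabulate e b (G ∘ (γ zero ∷_)) m (γ ∘ suc) k) ⟩
    -1ℤ * expand -1ℤ e b (G ∘ (γ zero ∷_)) (tabulate (γ ∘ suc)) k ∎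
    where
    open ≡-Reasoning
    t = λ j → e (γ (suc j)) * shift (b (γ (suc j))) (G (γ zero ∷ tabulate (γ ∘ suc ∘ punchIn j))) k

-- Colour signs along cycles and the switched matrix

signOf : Bool → ℤ
signOf true  = -1ℤ
signOf false = 1ℤ

signOf² : ∀ x → signOf x * signOf x ≡ 1ℤ
signOf² true  = refl
signOf² false = refl

arcsProduct : ∀ {A : Set} → (A → A → ℤ) → List (A × A) → ℤ
arcsProduct w = foldr (λ (i , j) x → w i j * x) 1ℤ

arcsProduct-cong : ∀ {A : Set} {w w′ : A → A → ℤ} {as} → All (λ (i , j) → w i j ≡ w′ i j) as →
                   arcsProduct w as ≡ arcsProduct w′ as
arcsProduct-cong []         = refl
arcsProduct-cong (eq ∷ eqs) = cong₂ _*_ eq (arcsProduct-cong eqs)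

arcsProduct-* : ∀ {A : Set} (w w′ : A → A → ℤ) as →
                arcsProduct (λ i j → w i j * w′ i j) as ≡ arcsProduct w as * arcsProduct w′ as
arcsProduct-* w w′ []             = refl
arcsProduct-* w w′ ((i , j) ∷ as) = trans (cong (w i j * w′ i j *_) (arcsProduct-* w w′ as))
  (lemma (w i j) (w′ i j) (arcsProduct w as) (arcsProduct w′ as))
  where
  lemma : ∀ a b c d → a * b * (c * d) ≡ a * c * (b * d)
  lemma = solve-∀

diagonal : ∀ {A : Set} → A → Site A A
diagonal i = site i i 1ℤ

module _ {A : Set} (w : A → A → ℤ) where

  -- `cycleArcs` ends with the closing arc, whereas `cycleProduct` begins with it.
  arcsProduct-walk : ∀ r vs e → arcsProduct w (consecutive (r ∷ vs ++ [ e ])) ≡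
    w (lastRow w r (map diagonal vs)) e * 1ℤ * walk w r (map diagonal vs)
  arcsProduct-walk r []       e = sym (ℤₚ.*-identityʳ _)
  arcsProduct-walk r (v ∷ vs) e = trans (cong (w r v *_) (arcsProduct-walk v vs e))
    (lemma (w r v) (w (lastRow w v (map diagonal vs)) e) (walk w v (map diagonal vs)))
    where
    lemma : ∀ a b c → a * (b * 1ℤ * c) ≡ b * 1ℤ * (a * 1ℤ * c)
    lemma = solve-∀

  cycleProduct-diagonal : ∀ v vs → cycleProduct w (map diagonal (v ∷ vs)) ≡ arcsProduct w (cycleArcs v vs)
  cycleProduct-diagonal v vs = sym (arcsProduct-walk v vs v)

map-≡-++ : ∀ {A B : Set} (f : A → B) ws ys {zs} → map f ws ≡ ys ++ zs → ∃₂ λ is js → ys ≡ map f is × ws ≡ is ++ js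
map-≡-++ f ws       []       eq = [] , ws , refl , refl
map-≡-++ f (w ∷ ws) (y ∷ ys) eq with refl , eq′ ← Listₚ.∷-injective eq
  with is , js , refl , refl ← map-≡-++ f ws ys eq′ = w ∷ is , js , refl , refl

-- Keeps the arcs of a cycle with at least two vertices off the diagonal, where `switchedSign` has
-- its artificial value.
distinct-cycleArcs : ∀ {A : Set} (v w : A) vs → Unique (v ∷ w ∷ vs) → All (λ (i , j) → i ≢ j) (cycleArcs v (w ∷ vs))
distinct-cycleArcs v w vs ((v≢w ∷ v∉vs) ∷ u) = v≢w ∷ path w vs (v≢w ∷ v∉vs) u
  where
  path : ∀ r xs → All (v ≢_) (r ∷ xs) → Unique (r ∷ xs) → All (λ (i , j) → i ≢ j) (consecutive (r ∷ xs ++ [ v ]))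
  path r []       (v≢r ∷ []) _                   = (v≢r ∘ sym) ∷ []
  path r (x ∷ xs) (_ ∷ v∉)   ((r≢x ∷ _) ∷ u)     = r≢x ∷ path x xs v∉ u

unique-prefix : ∀ {A : Set} (xs : List A) {ys} → Unique (xs ++ ys) → Unique xs
unique-prefix []       _        = []
unique-prefix (x ∷ xs) (x∉ ∷ u) = Allₚ.++⁻ˡ xs x∉ ∷ unique-prefix xs u

alternating : Bool → ℕ → ℤ
alternating b zero    = 1ℤ
alternating b (suc m) = signOf b * alternating (not b) m

flips : Bool → ℕ → Bool
flips b zero    = b
flips b (suc m) = flips (not b) m

-- Colours have period two along a walk, so a closed walk has even length and half of its tails
-- carry -1. Four steps change neither the residue nor the product; the initial colour is split so
-- that `flips` reduces.
alternating-closed : ∀ b m → flips b m ≡ b →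
  (m % 4 ≡ 0 × alternating b m ≡ 1ℤ) ⊎ (m % 4 ≡ 2 × alternating b m ≡ -1ℤ)
alternating-closed b     0 eq = inj₁ (refl , refl)
alternating-closed true  2 eq = inj₂ (refl , refl)
alternating-closed false 2 eq = inj₂ (refl , refl)
alternating-closed true  (suc (suc (suc (suc m)))) eq with alternating-closed true m eq
... | inj₁ (m%4 , alt) = inj₁ (m%4 , cong (λ x → -1ℤ * (1ℤ * (-1ℤ * (1ℤ * x)))) alt)
... | inj₂ (m%4 , alt) = inj₂ (m%4 , cong (λ x → -1ℤ * (1ℤ * (-1ℤ * (1ℤ * x)))) alt)
alternating-closed false (suc (suc (suc (suc m)))) eq with alternating-closed false m eq
... | inj₁ (m%4 , alt) = inj₁ (m%4 , cong (λ x → 1ℤ * (-1ℤ * (1ℤ * (-1ℤ * x)))) alt)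
... | inj₂ (m%4 , alt) = inj₂ (m%4 , cong (λ x → 1ℤ * (-1ℤ * (1ℤ * (-1ℤ * x)))) alt)
alternating-closed true  1 ()
alternating-closed false 1 ()
alternating-closed true  3 ()
alternating-closed false 3 ()

adj-nothing : ∀ {n} (S : SignedDigraph n) {i j} → S i j ≡ nothing → adj S i j ≡ 0ℤ
adj-nothing S {i} {j} eq with S i j
adj-nothing S refl | nothing = refl

isArcᵇ-nothing : ∀ {n} (S : SignedDigraph n) {i j} → S i j ≡ nothing → isArcᵇ S i j ≡ false
isArcᵇ-nothing S {i} {j} eq with S i j
isArcᵇ-nothing S refl | nothing = refl

isArcᵇ⇒IsArc : ∀ {n} (S : SignedDigraph n) {i j} → isArcᵇ S i j ≡ true → IsArc S (i , j)
isArcᵇ⇒IsArc S {i} {j} eq S≡nothing with () ← trans (sym eq) (isArcᵇ-nothing S S≡nothing)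

adj-dichotomy : ∀ {n} (S : SignedDigraph n) i j →
  (isArcᵇ S i j ≡ false × adj S i j ≡ 0ℤ) ⊎ (isArcᵇ S i j ≡ true × adj S i j * adj S i j ≡ 1ℤ)
adj-dichotomy S i j with S i j
... | nothing     = inj₁ (refl , refl)
... | just Sign.+ = inj₂ (refl , refl)
... | just Sign.- = inj₂ (refl , refl)

arcs-or-zero : ∀ {n} (S : SignedDigraph n) as → All (IsArc S) as ⊎ arcsProduct (adj S) as ≡ 0ℤ
arcs-or-zero S [] = inj₁ []
arcs-or-zero S ((i , j) ∷ as) with adj-dichotomy S i j | arcs-or-zero S as
... | inj₁ (_ , adj≡0) | _         = inj₂ (cong (_* arcsProduct (adj S) as) adj≡0)
... | inj₂ _           | inj₂ eq   = inj₂ (trans (cong (adj S i j *_) eq) (ℤₚ.*-zeroʳ (adj S i j)))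
... | inj₂ (arc , _)   | inj₁ arcs = inj₁ (isArcᵇ⇒IsArc S arc ∷ arcs)

module _ {n} (S : SignedDigraph n) (col : Fin n → Bool) where

  colourSign : Fin n → ℤ
  colourSign i = signOf (col i)

  -- The diagonal entries z of the characteristic matrix count as negative loops.
  switchedSign : Fin n → Fin n → ℤ
  switchedSign i j = if i == j then -1ℤ else adj S i j * colourSign i

  -- The colour sign appears here as well as in `switchedSign`. In the product it is squared, so the
  -- characteristic matrix itself is unchanged by the switching.
  weight : Fin n → Fin n → ℤ
  weight i j = if i == j then 1ℤ else ⟦ isArcᵇ S i j ⟧ * colourSign i

  weight-supported : ∀ i j → weight i j ≡ 0ℤ ⊎ IsUnit (switchedSign i j)
  weight-supported i j with i == j
  ... | true = inj₂ refl
  ... | false with adj-dichotomy S i j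
  ...   | inj₁ (noArc , _) = inj₁ (cong (λ b → ⟦ b ⟧ * colourSign i) noArc)
  ...   | inj₂ (_ , unit)  = inj₂ (*-isUnit (adj S i j) (colourSign i) unit (signOf² (col i)))

  charEntry : Fin n → Fin n → ℤ
  charEntry = negEntry switchedSign _==_ weight weight-supported

  coeff-charMatrix-*P : Loopless S → ∀ i j q k → coeff (charMatrix S i j *P q) k ≡ charEntry i j * shift (i == j) (coeff q) k
  coeff-charMatrix-*P loopless i j q k with i ≟ j
  ... | yes refl rewrite adj-nothing S (loopless i) = trans (coeff-z q k) (sym (ℤₚ.*-identityˡ _))
  ... | no _ = trans (coeff-constant (- adj S i j) q k) (cong (_* coeff q k) (sym entry))
    where
    entry : - (adj S i j * colourSign i * (⟦ isArcᵇ S i j ⟧ * colourSign i)) ≡ - adj S i j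
    entry with adj-dichotomy S i j
    ... | inj₁ (_ , adj≡0) rewrite adj≡0 = refl
    ... | inj₂ (arc , _) rewrite arc = trans (lemma (adj S i j) (colourSign i))
      (trans (cong (λ x → - (adj S i j * x)) (signOf² (col i))) (cong -_ (ℤₚ.*-identityʳ (adj S i j))))
      where
      lemma : ∀ a c → - (a * c * (1ℤ * c)) ≡ - (a * (c * c))
      lemma = solve-∀

  det-expansion : Loopless S → ∀ m (ρ γ : Fin m → Fin n) k →
    coeff (det m (λ i j → charMatrix S (ρ i) (γ j))) k ≡ expansion -1ℤ charEntry _==_ (tabulate ρ) (tabulate γ) k
  det-expansion loopless zero    ρ γ k = refl
  det-expansion loopless (suc m) ρ γ k = begin
    coeff (det (suc m) (λ i j → charMatrix S (ρ i) (γ j))) k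
      ≡⟨ coeff-sumP (λ j → scaleP (altSign (toℕ j)) (charMatrix S (ρ zero) (γ j) *P minor j)) (allFin (suc m)) k ⟩
    ∑ (allFin (suc m)) (λ j → coeff (scaleP (altSign (toℕ j)) (charMatrix S (ρ zero) (γ j) *P minor j)) k)
      ≡⟨ ∑-cong (allFin (suc m)) (λ j → trans (coeff-scaleP (altSign (toℕ j)) (charMatrix S (ρ zero) (γ j) *P minor j) k) (cong (altSign (toℕ j) *_)
           (trans (coeff-charMatrix-*P loopless (ρ zero) (γ j) (minor j) k)
             (cong (charEntry (ρ zero) (γ j) *_) (shift-cong (ρ zero == γ j) (det-expansion loopless m (ρ ∘ suc) (γ ∘ punchIn j)) k))))) ⟩
    ∑ (allFin (suc m)) (λ j → altSign (toℕ j) * (charEntry (ρ zero) (γ j) *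
        shift (ρ zero == γ j) (expansion -1ℤ charEntry _==_ (tabulate (ρ ∘ suc)) (tabulate (γ ∘ punchIn j))) k))
      ≡⟨ expand-tabulate (charEntry (ρ zero)) (ρ zero ==_) (expansion -1ℤ charEntry _==_ (tabulate (ρ ∘ suc))) m γ k ⟩
    expansion -1ℤ charEntry _==_ (tabulate ρ) (tabulate γ) k ∎
    where
    open ≡-Reasoning
    minor = λ j → det m (λ r c → charMatrix S (ρ (suc r)) (γ (punchIn j c)))

  switched-factor : ∀ v w ws → Unique (v ∷ w ∷ ws) → arcsProduct switchedSign (cycleArcs v (w ∷ ws)) ≡
    arcsProduct (adj S) (cycleArcs v (w ∷ ws)) * arcsProduct (λ i _ → colourSign i) (cycleArcs v (w ∷ ws))
  switched-factor v w ws unique = trans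
    (arcsProduct-cong (All.map (λ {(i , j)} i≢j → cong (λ b → if b then -1ℤ else adj S i j * colourSign i) (==-≢ i≢j))
      (distinct-cycleArcs v w ws unique)))
    (arcsProduct-* (adj S) (λ i _ → colourSign i) (cycleArcs v (w ∷ ws)))

  signs-diagonal : ∀ is → signs switchedSign (map diagonal is) ≡ 1ℤ
  signs-diagonal []       = refl
  signs-diagonal (i ∷ is) = trans (ℤₚ.*-identityˡ _) (signs-diagonal is)

  module _ (proper : ∀ i j → S i j ≢ nothing → col i ≢ col j)
    (neg : (v : Fin n) (vs : List (Fin n)) → IsDirectedCycle S v vs → cycleLength v vs % 4 ≡ 0 → cycleSign S v vs ≡ -1ℤ)
    (pos : (v : Fin n) (vs : List (Fin n)) → IsDirectedCycle S v vs → cycleLength v vs % 4 ≡ 2 → cycleSign S v vs ≡ 1ℤ) where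

    colours-along-walk : ∀ r vs e → All (IsArc S) (consecutive (r ∷ vs ++ [ e ])) →
      arcsProduct (λ i _ → colourSign i) (consecutive (r ∷ vs ++ [ e ])) ≡ alternating (col r) (suc (length vs))
        × col e ≡ flips (col r) (suc (length vs))
    colours-along-walk r []       e (arc ∷ [])   = refl , Boolₚ.¬-not (proper r e arc ∘ sym)
    colours-along-walk r (v ∷ vs) e (arc ∷ arcs) with colours-along-walk v vs e arcs
    ... | product , end rewrite Boolₚ.¬-not (proper r v arc ∘ sym) = cong (colourSign r *_) product , end

    -- A single vertex is a loop of sign -1. Otherwise, a sequence that is not a directed cycle has
    -- product 0; for length 0 mod 4 the cycle sign -1 meets the colour product 1, and for length 2
    -- mod 4 the sign 1 meets -1.
    switched-cycle : ∀ v vs → Unique (v ∷ vs) →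
      arcsProduct switchedSign (cycleArcs v vs) ≡ 0ℤ ⊎ arcsProduct switchedSign (cycleArcs v vs) ≡ -1ℤ
    switched-cycle v [] _ = inj₂ (cong (λ b → (if b then -1ℤ else adj S v v * colourSign v) * 1ℤ) (==-refl v))
    switched-cycle v vs@(w ∷ ws) unique rewrite switched-factor v w ws unique with arcs-or-zero S (cycleArcs v vs)
    ... | inj₂ zero-product rewrite zero-product = inj₁ refl
    ... | inj₁ arcs with product , closed ← colours-along-walk v vs v arcs
      with alternating-closed (col v) (length (v ∷ vs)) (sym closed)
    ...   | inj₁ (ℓ%4 , alt) = inj₂ (cong₂ _*_ (neg v vs (unique , arcs) ℓ%4) (trans product alt))
    ...   | inj₂ (ℓ%4 , alt) = inj₂ (cong₂ _*_ (pos v vs (unique , arcs) ℓ%4) (trans product alt))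

    switched-negative : AllCyclesNegative switchedSign (map diagonal (allFin n))
    switched-negative ys zs perm
      with ws , eq , allFin↭ws ← ↭-map-inv diagonal (↭-sym perm)
      with map-≡-++ diagonal ws ys (sym eq)
    ... | []     , _  , refl , _    = inj₂ refl
    -- The selected vertices form a prefix of a rearrangement of all vertices, hence are distinct.
    ... | v ∷ vs , js , refl , refl = subst (λ x → x ≡ 0ℤ ⊎ x ≡ -1ℤ) (sym (cycleProduct-diagonal switchedSign v vs))
      (switched-cycle v vs (unique-prefix (v ∷ vs) (Permutationₛ.Unique-resp-↭ (setoid (Fin n)) (↭⇒↭ₛ allFin↭ws) (allFin⁺ n))))

    charPoly-permanent : Loopless S → ∀ k → coeff (charPoly S) k ≡ expansion 1ℤ weight _==_ (allFin n) (allFin n) k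
    charPoly-permanent loopless k = begin
      coeff (charPoly S) k
        ≡⟨ det-expansion loopless n id id k ⟩
      expansion -1ℤ charEntry _==_ (allFin n) (allFin n) k
        ≡⟨ cong₂ (λ x y → expansion -1ℤ charEntry _==_ x y k) (sym rows) (sym cols) ⟩
      expansion -1ℤ charEntry _==_ (map Site.row vs) (map Site.col vs) k
        ≡⟨ det≡perm switchedSign _==_ weight weight-supported _ vs refl switched-negative
             (Allₚ.map⁺ (All.universal (λ _ → refl) (allFin n))) k ⟩
      signs switchedSign vs * expansion 1ℤ weight _==_ (map Site.row vs) (map Site.col vs) k
        ≡⟨ trans (cong (_* expansion 1ℤ weight _==_ (map Site.row vs) (map Site.col vs) k) (signs-diagonal (allFin n))) (ℤₚ.*-identityˡ _) ⟩
      expansion 1ℤ weight _==_ (map Site.row vs) (map Site.col vs) k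
        ≡⟨ cong₂ (λ x y → expansion 1ℤ weight _==_ x y k) rows cols ⟩
      expansion 1ℤ weight _==_ (allFin n) (allFin n) k ∎
      where
      open ≡-Reasoning
      vs = map diagonal (allFin n)
      rows : map Site.row vs ≡ allFin n
      rows = trans (sym (Listₚ.map-∘ (allFin n))) (Listₚ.map-id (allFin n))
      cols : map Site.col vs ≡ allFin n
      cols = trans (sym (Listₚ.map-∘ (allFin n))) (Listₚ.map-id (allFin n))

-- The permanent as a sum over words

bump : Bool → ℕ → ℕ
bump true  m = suc m
bump false m = m

bump-injective : ∀ b {m m′} → bump b m ≡ bump b m′ → m ≡ m′
bump-injective true  eq = ℕₚ.suc-injective eq
bump-injective false eq = eq

+bump : ∀ b m → ℤ.+ bump b m ≡ ⟦ b ⟧ + ℤ.+ m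
+bump true  m = refl
+bump false m = sym (ℤₚ.+-identityˡ (ℤ.+ m))

bump-≡ᵇ-shift : ∀ b m k → ⟦ bump b m ℕ.≡ᵇ k ⟧ ≡ shift b (λ k → ⟦ m ℕ.≡ᵇ k ⟧) k
bump-≡ᵇ-shift false m k       = refl
bump-≡ᵇ-shift true  m zero    = refl
bump-≡ᵇ-shift true  m (suc k) = refl

altSign-bump : ∀ b m → altSign (bump b m) ≡ signOf b * altSign m
altSign-bump true  m = altSign-suc m
altSign-bump false m = sym (ℤₚ.*-identityˡ (altSign m))

==-sym : ∀ {n} (i j : Fin n) → (i == j) ≡ (j == i)
==-sym i j with i ≟ j
... | yes refl = sym (==-refl i)
... | no i≢j   = sym (==-≢ (i≢j ∘ sym))

∧-elimˡ : ∀ {a b} → a ∧ b ≡ true → a ≡ true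
∧-elimˡ {true} _ = refl

∧-elimʳ : ∀ {a b} → a ∧ b ≡ true → b ≡ true
∧-elimʳ {true} eq = eq

∧-intro : ∀ {a b} → a ≡ true → b ≡ true → a ∧ b ≡ true
∧-intro refl refl = refl

⟦⟧-refuted : ∀ {b} → ¬ b ≡ true → ⟦ b ⟧ ≡ 0ℤ
⟦⟧-refuted {false} _ = refl
⟦⟧-refuted {true}  ¬b = ⊥-elim (¬b refl)

length-filterᵇ-tabulate : ∀ {A B : Set} {n} (f : A → Bool) (g : B → Bool) {h : Fin n → A} {h′ : Fin n → B} →
  (∀ i → f (h i) ≡ g (h′ i)) → length (filterᵇ f (tabulate h)) ≡ length (filterᵇ g (tabulate h′))
length-filterᵇ-tabulate {n = zero} f g eq = refl
length-filterᵇ-tabulate {n = suc n} f g {h} {h′} eq with f (h zero) | g (h′ zero) | eq zero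
... | true  | true  | refl = cong suc (length-filterᵇ-tabulate f g (eq ∘ suc))
... | false | false | refl = length-filterᵇ-tabulate f g (eq ∘ suc)

countTrue-cong : ∀ {n} {f g : Fin n → Bool} → f ≗ g → countTrue f ≡ countTrue g
countTrue-cong {f = f} {g} = length-filterᵇ-tabulate f g

countTrue-suc : ∀ {n} (f : Fin (suc n) → Bool) → countTrue f ≡ bump (f zero) (countTrue (f ∘ suc))
countTrue-suc f with f zero
... | true  = cong suc (length-filterᵇ-tabulate f (f ∘ suc) {suc} {id} (λ _ → refl))
... | false = length-filterᵇ-tabulate f (f ∘ suc) {suc} {id} (λ _ → refl)

+countTrue : ∀ {n} (f : Fin n → Bool) → ℤ.+ countTrue f ≡ ∑ (allFin n) (⟦_⟧ ∘ f)
+countTrue f = length-filterᵇ f (allFin _)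

countTrue-false : ∀ n → countTrue {n} (λ _ → false) ≡ 0
countTrue-false n = ℤₚ.+-injective (trans (+countTrue {n} (λ _ → false)) (∑-zero (allFin n) (λ _ → refl)))

countTrue-== : ∀ {n} (i : Fin n) → countTrue (i ==_) ≡ 1
countTrue-== {n} i = ℤₚ.+-injective (begin
  ℤ.+ countTrue (i ==_)                   ≡⟨ +countTrue (i ==_) ⟩
  ∑ (allFin n) (λ j → ⟦ i == j ⟧)         ≡⟨ ∑-cong (allFin n) (λ j → sym (ℤₚ.*-identityʳ ⟦ i == j ⟧)) ⟩
  ∑ (allFin n) (λ j → ⟦ i == j ⟧ * 1ℤ)    ≡⟨ ∑-δ i (λ _ → 1ℤ) ⟩
  1ℤ                                      ∎)
  where open ≡-Reasoning

countTrue-≥1 : ∀ {n} (f : Fin n → Bool) j → f j ≡ true → ∃ λ m → countTrue f ≡ suc m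
countTrue-≥1 f zero    fj = _ , trans (countTrue-suc f) (cong (λ b → bump b (countTrue (f ∘ suc))) fj)
countTrue-≥1 f (suc j) fj with m , eq ← countTrue-≥1 (f ∘ suc) j fj with f zero | countTrue-suc f
... | true  | eq′ = _ , eq′
... | false | eq′ = m , trans eq′ eq

countTrue-≥2 : ∀ {n} (f : Fin n → Bool) j j′ → j ≢ j′ → f j ≡ true → f j′ ≡ true → ∃ λ m → countTrue f ≡ suc (suc m)
countTrue-≥2 f zero    zero     j≢j′ fj fj′ = ⊥-elim (j≢j′ refl)
countTrue-≥2 f zero    (suc j′) j≢j′ fj fj′ with m , eq ← countTrue-≥1 (f ∘ suc) j′ fj′ =
  m , trans (countTrue-suc f) (cong₂ bump fj eq)
countTrue-≥2 f (suc j) zero     j≢j′ fj fj′ with m , eq ← countTrue-≥1 (f ∘ suc) j fj =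
  m , trans (countTrue-suc f) (cong₂ bump fj′ eq)
countTrue-≥2 f (suc j) (suc j′) j≢j′ fj fj′ with m , eq ← countTrue-≥2 (f ∘ suc) j j′ (j≢j′ ∘ cong suc) fj fj′
  with f zero | countTrue-suc f
... | true  | eq′ = suc m , trans eq′ (cong suc eq)
... | false | eq′ = m , trans eq′ eq

countTrue-not : ∀ {n} (f : Fin n → Bool) → countTrue (not ∘ f) ℕ.+ countTrue f ≡ n
countTrue-not {zero}  f = refl
countTrue-not {suc n} f rewrite countTrue-suc f | countTrue-suc (not ∘ f) with f zero
... | true  = trans (ℕₚ.+-suc _ _) (cong suc (countTrue-not (f ∘ suc)))
... | false = cong suc (countTrue-not (f ∘ suc))

foldr-∧-tabulate : ∀ {A B : Set} {n} (f : A → Bool) (g : B → Bool) {h : Fin n → A} {h′ : Fin n → B} →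
  (∀ i → f (h i) ≡ g (h′ i)) →
  foldr (λ x b → f x ∧ b) true (tabulate h) ≡ foldr (λ x b → g x ∧ b) true (tabulate h′)
foldr-∧-tabulate {n = zero}  f g eq = refl
foldr-∧-tabulate {n = suc n} f g eq = cong₂ _∧_ (eq zero) (foldr-∧-tabulate f g (eq ∘ suc))

allFinᵇ-cong : ∀ {n} {f g : Fin n → Bool} → f ≗ g → allFinᵇ f ≡ allFinᵇ g
allFinᵇ-cong {f = f} {g} = foldr-∧-tabulate f g

allFinᵇ-suc : ∀ {n} (f : Fin (suc n) → Bool) → allFinᵇ f ≡ f zero ∧ allFinᵇ (f ∘ suc)
allFinᵇ-suc f = cong (f zero ∧_) (foldr-∧-tabulate f (f ∘ suc) {suc} {id} (λ _ → refl))

allFinᵇ-elim : ∀ {n} (f : Fin n → Bool) → allFinᵇ f ≡ true → ∀ i → f i ≡ true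
allFinᵇ-elim f all zero    = ∧-elimˡ all
allFinᵇ-elim f all (suc i) = allFinᵇ-elim (f ∘ suc) (∧-elimʳ {f zero} (trans (sym (allFinᵇ-suc f)) all)) i

allFinᵇ-intro : ∀ {n} (f : Fin n → Bool) → (∀ i → f i ≡ true) → allFinᵇ f ≡ true
allFinᵇ-intro {zero}  f all = refl
allFinᵇ-intro {suc n} f all = trans (allFinᵇ-suc f) (∧-intro (all zero) (allFinᵇ-intro (f ∘ suc) (all ∘ suc)))

allFinᵇ-implies-== : ∀ {n} (i : Fin n) (f : Fin n → Bool) → allFinᵇ (λ j → implies (i == j) (f j)) ≡ f i
allFinᵇ-implies-== {suc n} zero    f = trans (allFinᵇ-suc (λ j → implies (zero == j) (f j))) (trans
  (cong (f zero ∧_) (allFinᵇ-intro {n} (λ _ → true) (λ _ → refl))) (Boolₚ.∧-identityʳ (f zero)))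
allFinᵇ-implies-== {suc n} (suc i) f =
  trans (allFinᵇ-suc (λ j → implies (suc i == j) (f j))) (allFinᵇ-implies-== i (f ∘ suc))

∏ : ∀ {n} → (Fin n → ℤ) → ℤ
∏ {zero}  f = 1ℤ
∏ {suc n} f = f zero * ∏ (f ∘ suc)

∏-signs : ∀ {n} (f : Fin n → ℤ) p q → (∀ i → f i ≡ ⟦ p i ⟧ * signOf (q i)) → ∏ f ≡ ⟦ allFinᵇ p ⟧ * altSign (countTrue q)
∏-signs {zero}  f p q eq = refl
∏-signs {suc n} f p q eq = begin
  f zero * ∏ (f ∘ suc)
    ≡⟨ cong₂ _*_ (eq zero) (∏-signs (f ∘ suc) (p ∘ suc) (q ∘ suc) (eq ∘ suc)) ⟩
  ⟦ p zero ⟧ * signOf (q zero) * (⟦ allFinᵇ (p ∘ suc) ⟧ * altSign (countTrue (q ∘ suc)))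
    ≡⟨ lemma ⟦ p zero ⟧ (signOf (q zero)) ⟦ allFinᵇ (p ∘ suc) ⟧ (altSign (countTrue (q ∘ suc))) ⟩
  ⟦ p zero ⟧ * ⟦ allFinᵇ (p ∘ suc) ⟧ * (signOf (q zero) * altSign (countTrue (q ∘ suc)))
    ≡⟨ cong₂ _*_ (sym (trans (cong ⟦_⟧ (allFinᵇ-suc p)) (⟦∧⟧ (p zero) (allFinᵇ (p ∘ suc)))))
         (sym (trans (cong altSign (countTrue-suc q)) (altSign-bump (q zero) (countTrue (q ∘ suc))))) ⟩
  ⟦ allFinᵇ p ⟧ * altSign (countTrue q) ∎
  where
  open ≡-Reasoning
  lemma : ∀ a b c d → a * b * (c * d) ≡ a * c * (b * d)
  lemma = solve-∀

module _ {n : ℕ} where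

  mem : Fin n → List (Fin n) → Bool
  mem x []       = false
  mem x (c ∷ cs) = (c == x) ∨ mem x cs

  remove : Fin n → List (Fin n) → List (Fin n)
  remove x []       = []
  remove x (c ∷ cs) = if c == x then cs else c ∷ remove x cs

  -- Letters are removed in the order in which the row expansion uses up columns. Comparing
  -- multiplicities later turns this test into a condition on degrees.
  isPermᵇ : List (Fin n) → List (Fin n) → Bool
  isPermᵇ []       []       = true
  isPermᵇ []       (_ ∷ _)  = false
  isPermᵇ (x ∷ xs) cs       = mem x cs ∧ isPermᵇ xs (remove x cs)

  occurrences : Fin n → List (Fin n) → ℕ
  occurrences x []       = 0
  occurrences x (c ∷ cs) = bump (c == x) (occurrences x cs)

  +occurrences : ∀ x cs → ℤ.+ occurrences x cs ≡ ∑ cs (λ c → ⟦ c == x ⟧)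
  +occurrences x []       = refl
  +occurrences x (c ∷ cs) = trans (+bump (c == x) _) (cong (⟦ c == x ⟧ +_) (+occurrences x cs))

  mem-fresh : ∀ {x cs} → All (x ≢_) cs → mem x cs ≡ false
  mem-fresh []           = refl
  mem-fresh (x≢c ∷ x∉cs) = cong₂ _∨_ (==-≢ (x≢c ∘ sym)) (mem-fresh x∉cs)

  occurrences-∉ : ∀ x cs → mem x cs ≡ false → occurrences x cs ≡ 0
  occurrences-∉ x []       _  = refl
  occurrences-∉ x (c ∷ cs) eq with c == x
  ... | false = occurrences-∉ x cs eq

  occurrences-remove : ∀ x y cs → mem x cs ≡ true → occurrences y cs ≡ bump (x == y) (occurrences y (remove x cs))
  occurrences-remove x y (c ∷ cs) eq with c ≟ x
  ... | yes refl = refl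
  ... | no _ with c == y | x == y | occurrences-remove x y cs eq
  ...   | true  | true  | eq′ = cong suc eq′
  ...   | true  | false | eq′ = cong suc eq′
  ...   | false | true  | eq′ = eq′
  ...   | false | false | eq′ = eq′

  isPermᵇ⇒occurrences : ∀ xs cs → isPermᵇ xs cs ≡ true → ∀ y → occurrences y xs ≡ occurrences y cs
  isPermᵇ⇒occurrences []       []       _    y = refl
  isPermᵇ⇒occurrences (x ∷ xs) cs       perm y = trans
    (cong (bump (x == y)) (isPermᵇ⇒occurrences xs (remove x cs) (∧-elimʳ {mem x cs} perm) y))
    (sym (occurrences-remove x y cs (∧-elimˡ perm)))

  occurrences⇒isPermᵇ : ∀ xs cs → (∀ y → occurrences y xs ≡ occurrences y cs) → isPermᵇ xs cs ≡ true
  occurrences⇒isPermᵇ []       []       eq = refl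
  occurrences⇒isPermᵇ []       (c ∷ cs) eq with eq c
  ... | eqc rewrite ==-refl c with () ← eqc
  occurrences⇒isPermᵇ (x ∷ xs) cs       eq with mem x cs in x∈?cs
  ... | true  = occurrences⇒isPermᵇ xs (remove x cs) (λ y → bump-injective (x == y) (trans (eq y) (occurrences-remove x y cs x∈?cs)))
  ... | false with eq x
  ...   | eqx rewrite ==-refl x with () ← trans eqx (occurrences-∉ x cs x∈?cs)

  occurrences-allFin : ∀ x → occurrences x (allFin n) ≡ 1
  occurrences-allFin x = ℤₚ.+-injective (begin
    ℤ.+ occurrences x (allFin n)       ≡⟨ +occurrences x (allFin n) ⟩
    ∑ (allFin n) (λ c → ⟦ c == x ⟧)    ≡⟨ ∑-cong (allFin n) (λ c → cong ⟦_⟧ (==-sym c x)) ⟩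
    ∑ (allFin n) (λ c → ⟦ x == c ⟧)    ≡⟨ sym (+countTrue (x ==_)) ⟩
    ℤ.+ countTrue (x ==_)              ≡⟨ cong ℤ.+_ (countTrue-== x) ⟩
    1ℤ                                 ∎)
    where open ≡-Reasoning

  isPermᵇ-allFin : ∀ xs → isPermᵇ xs (allFin n) ≡ allFinᵇ (λ j → occurrences j xs ℕ.≡ᵇ 1)
  isPermᵇ-allFin xs = Boolₚ.⇔→≡ {z = true} (mk⇔
    (λ perm → allFinᵇ-intro _ (λ j → cong (ℕ._≡ᵇ 1) (trans (isPermᵇ⇒occurrences xs (allFin n) perm j) (occurrences-allFin j))))
    (λ all → occurrences⇒isPermᵇ xs (allFin n) (λ j → trans (≡ᵇ1⇒≡1 _ (allFinᵇ-elim _ all j)) (sym (occurrences-allFin j)))))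
    where
    ≡ᵇ1⇒≡1 : ∀ m → (m ℕ.≡ᵇ 1) ≡ true → m ≡ 1
    ≡ᵇ1⇒≡1 1 _ = refl

  all-remove : ∀ {P : Fin n → Set} x {cs} → All P cs → All P (remove x cs)
  all-remove x []                  = []
  all-remove x (_∷_ {c} pc pcs) with c == x
  ... | true  = pcs
  ... | false = pc ∷ all-remove x pcs

  unique-remove : ∀ x {cs} → Unique cs → Unique (remove x cs)
  unique-remove x []                = []
  unique-remove x (_∷_ {c} c∉cs u) with c == x
  ... | true  = u
  ... | false = all-remove x c∉cs ∷ unique-remove x u

  shift-∑ : ∀ {A : Set} b xs (a : A → ℤ) (g : A → ℕ → ℤ) k →
            shift b (λ k → ∑ xs (λ x → a x * g x k)) k ≡ ∑ xs (λ x → a x * shift b (g x) k)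
  shift-∑ false xs a g k       = refl
  shift-∑ true  xs a g zero    = sym (∑-zero xs (λ x → ℤₚ.*-zeroʳ (a x)))
  shift-∑ true  xs a g (suc k) = refl

  -- `expand` sums over positions, words choose labels. Because the columns are distinct, a label
  -- equal to the head occurs nowhere else and the two sums agree.
  expand-select : ∀ e b G {cs} → Unique cs → ∀ k →
    expand 1ℤ e b G cs k ≡ ∑ (allFin n) (λ x → ⟦ mem x cs ⟧ * (e x * shift (b x) (G (remove x cs)) k))
  expand-select e b G []                   k = sym (∑-zero (allFin n) (λ _ → refl))
  expand-select e b G (_∷_ {c} {cs} c∉cs u) k = begin
    head c + 1ℤ * expand 1ℤ e b (G ∘ (c ∷_)) cs k
      ≡⟨ cong₂ _+_ (sym (∑-δ c head)) (trans (ℤₚ.*-identityˡ _) (expand-select e b (G ∘ (c ∷_)) u k)) ⟩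
    ∑ (allFin n) (λ x → ⟦ c == x ⟧ * head x) + ∑ (allFin n) (λ x → ⟦ mem x cs ⟧ * rest x)
      ≡⟨ sym (∑-+ (allFin n) _ _) ⟩
    ∑ (allFin n) (λ x → ⟦ c == x ⟧ * head x + ⟦ mem x cs ⟧ * rest x)
      ≡⟨ ∑-cong (allFin n) merge ⟩
    ∑ (allFin n) (λ x → ⟦ mem x (c ∷ cs) ⟧ * (e x * shift (b x) (G (remove x (c ∷ cs))) k)) ∎
    where
    open ≡-Reasoning
    head = λ x → e x * shift (b x) (G cs) k
    rest = λ x → e x * shift (b x) (G (c ∷ remove x cs)) k
    merge : ∀ x → ⟦ c == x ⟧ * head x + ⟦ mem x cs ⟧ * rest x
      ≡ ⟦ mem x (c ∷ cs) ⟧ * (e x * shift (b x) (G (remove x (c ∷ cs))) k)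
    merge x with c ≟ x
    ... | yes refl = trans (cong (λ m → 1ℤ * head c + ⟦ m ⟧ * rest c) (mem-fresh c∉cs)) (ℤₚ.+-identityʳ (1ℤ * head c))
    ... | no _     = ℤₚ.+-identityˡ (⟦ mem x cs ⟧ * rest x)

  module _ {R : Set} (e : R → Fin n → ℤ) (b : R → Fin n → Bool) where

    monomialTerm : ∀ m → (Fin m → R) → (Fin m → Fin n) → ℕ → ℤ
    monomialTerm zero    ρ F k = coeff [ 1ℤ ] k
    monomialTerm (suc m) ρ F k = e (ρ zero) (F zero) * shift (b (ρ zero) (F zero)) (monomialTerm m (ρ ∘ suc) (F ∘ suc)) k

    monomialTerm-cong : ∀ m ρ {F F′} → F ≗ F′ → ∀ k → monomialTerm m ρ F k ≡ monomialTerm m ρ F′ k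
    monomialTerm-cong zero    ρ eq k = refl
    monomialTerm-cong (suc m) ρ {F} {F′} eq k rewrite eq zero =
      cong (e (ρ zero) (F′ zero) *_) (shift-cong (b (ρ zero) (F′ zero)) (monomialTerm-cong m (ρ ∘ suc) (eq ∘ suc)) k)

    monomialTerm-∏ : ∀ m ρ F k → monomialTerm m ρ F k ≡
      ∏ (λ i → e (ρ i) (F i)) * ⟦ countTrue (λ i → b (ρ i) (F i)) ℕ.≡ᵇ k ⟧
    monomialTerm-∏ zero    ρ F zero    = refl
    monomialTerm-∏ zero    ρ F (suc k) = refl
    monomialTerm-∏ (suc m) ρ F k = begin
      e₀ * shift b₀ (monomialTerm m (ρ ∘ suc) (F ∘ suc)) k
        ≡⟨ cong (e₀ *_) (shift-scale b₀ es (monomialTerm-∏ m (ρ ∘ suc) (F ∘ suc)) k) ⟩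
      e₀ * (es * shift b₀ (λ k → ⟦ countTrue (λ i → b (ρ (suc i)) (F (suc i))) ℕ.≡ᵇ k ⟧) k)
        ≡⟨ sym (ℤₚ.*-assoc e₀ es _) ⟩
      e₀ * es * shift b₀ (λ k → ⟦ countTrue (λ i → b (ρ (suc i)) (F (suc i))) ℕ.≡ᵇ k ⟧) k
        ≡⟨ cong (e₀ * es *_) (sym (trans (cong (λ c → ⟦ c ℕ.≡ᵇ k ⟧) (countTrue-suc (λ i → b (ρ i) (F i)))) (bump-≡ᵇ-shift b₀ _ k))) ⟩
      e₀ * es * ⟦ countTrue (λ i → b (ρ i) (F i)) ℕ.≡ᵇ k ⟧ ∎
      where
      open ≡-Reasoning
      e₀ = e (ρ zero) (F zero)
      b₀ = b (ρ zero) (F zero)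
      es = ∏ (λ i → e (ρ (suc i)) (F (suc i)))

    permanent-words : ∀ m (ρ : Fin m → R) {cs} → Unique cs → ∀ k →
      expansion 1ℤ e b (tabulate ρ) cs k ≡
      ∑ (allFuns m (allFin n)) (λ F → ⟦ isPermᵇ (tabulate F) cs ⟧ * monomialTerm m ρ F k)
    permanent-words zero ρ {[]}    u k = sym (trans (ℤₚ.+-identityʳ _) (ℤₚ.*-identityˡ _))
    permanent-words zero ρ {_ ∷ _} u k = refl
    permanent-words (suc m) ρ {cs} u k = begin
      expand 1ℤ (e (ρ zero)) (b (ρ zero)) (expansion 1ℤ e b (tabulate (ρ ∘ suc))) cs k
        ≡⟨ expand-select (e (ρ zero)) (b (ρ zero)) _ u k ⟩
      ∑ (allFin n) (λ x → ⟦ mem x cs ⟧ * (e (ρ zero) x * shift (b (ρ zero) x) (expansion 1ℤ e b (tabulate (ρ ∘ suc)) (remove x cs)) k))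
        ≡⟨ ∑-cong (allFin n) choose ⟩
      ∑ (allFin n) (λ x → ∑ (allFuns m (allFin n)) (λ F → ⟦ isPermᵇ (tabulate (x ◂ F)) cs ⟧ * monomialTerm (suc m) ρ (x ◂ F) k))
        ≡⟨ sym (∑-allFuns m (allFin n) _ (λ eq → cong₂ _*_
             (cong (λ L → ⟦ isPermᵇ L cs ⟧) (Listₚ.tabulate-cong eq)) (monomialTerm-cong (suc m) ρ eq k))) ⟩
      ∑ (allFuns (suc m) (allFin n)) (λ F → ⟦ isPermᵇ (tabulate F) cs ⟧ * monomialTerm (suc m) ρ F k) ∎
      where
      open ≡-Reasoning
      choose : ∀ x →
        ⟦ mem x cs ⟧ * (e (ρ zero) x * shift (b (ρ zero) x) (expansion 1ℤ e b (tabulate (ρ ∘ suc)) (remove x cs)) k)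
        ≡ ∑ (allFuns m (allFin n)) (λ F → ⟦ isPermᵇ (tabulate (x ◂ F)) cs ⟧ * monomialTerm (suc m) ρ (x ◂ F) k)
      choose x = begin
        μ * (e₀ * shift b₀ (expansion 1ℤ e b (tabulate (ρ ∘ suc)) (remove x cs)) k)
          ≡⟨ cong (λ y → μ * (e₀ * y)) (trans (shift-cong b₀ (permanent-words m (ρ ∘ suc) (unique-remove x u)) k)
               (shift-∑ b₀ Fs π (λ F → monomialTerm m (ρ ∘ suc) F) k)) ⟩
        μ * (e₀ * ∑ Fs (λ F → π F * τ F))
          ≡⟨ trans (cong (μ *_) (sym (∑-*ˡ Fs e₀ (λ F → π F * τ F)))) (sym (∑-*ˡ Fs μ (λ F → e₀ * (π F * τ F)))) ⟩
        ∑ Fs (λ F → μ * (e₀ * (π F * τ F)))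
          ≡⟨ ∑-cong Fs (λ F → trans (lemma μ e₀ (π F) (τ F)) (cong (_* (e₀ * τ F)) (sym (⟦∧⟧ (mem x cs) _)))) ⟩
        ∑ Fs (λ F → ⟦ isPermᵇ (tabulate (x ◂ F)) cs ⟧ * monomialTerm (suc m) ρ (x ◂ F) k) ∎
        where
        Fs = allFuns m (allFin n)
        μ  = ⟦ mem x cs ⟧
        e₀ = e (ρ zero) x
        b₀ = b (ρ zero) x
        π  = λ F → ⟦ isPermᵇ (tabulate F) (remove x cs) ⟧
        τ  = λ F → shift b₀ (monomialTerm m (ρ ∘ suc) F) k
        lemma : ∀ a b c d → a * (b * (c * d)) ≡ a * c * (b * d)
        lemma = solve-∀

-- Linear subsidigraphs

-- With `a` the order of a subsidigraph and `c` the number of vertices outside it, this states that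
-- the exponent of z is `k` without a subtraction.
+-≡ᵇ : ∀ a c k {n} → a ℕ.+ c ≡ n → (a ℕ.+ k ℕ.≡ᵇ n) ≡ (c ℕ.≡ᵇ k)
+-≡ᵇ zero    zero    zero    refl = refl
+-≡ᵇ zero    zero    (suc k) refl = refl
+-≡ᵇ zero    (suc c) zero    refl = refl
+-≡ᵇ zero    (suc c) (suc k) refl = +-≡ᵇ zero c k refl
+-≡ᵇ (suc a) c       k       refl = +-≡ᵇ a c k refl

-- The index map `h` is a parameter because the recursion of `applyUpTo` composes it with `suc`.
∑-applyUpTo-δ : ∀ M (h : ℕ → ℕ) t (f g : ℕ → ℤ) → t ℕ.< M → (∀ j → g (h j) ≡ ⟦ t ℕ.≡ᵇ j ⟧ * f j) →
  ∑ (applyUpTo h M) g ≡ f t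
∑-applyUpTo-δ (suc M) h zero f g t<M eq = begin
  g (h 0) + ∑ (applyUpTo (h ∘ suc) M) g    ≡⟨ cong₂ _+_ (trans (eq 0) (ℤₚ.*-identityˡ (f 0))) (vanish M (h ∘ suc) (eq ∘ suc)) ⟩
  f 0 + 0ℤ                                 ≡⟨ ℤₚ.+-identityʳ (f 0) ⟩
  f 0                                      ∎
  where
  open ≡-Reasoning
  vanish : ∀ M h → (∀ j → g (h j) ≡ 0ℤ) → ∑ (applyUpTo h M) g ≡ 0ℤ
  vanish zero    h eq = refl
  vanish (suc M) h eq = cong₂ _+_ (eq 0) (vanish M (h ∘ suc) (eq ∘ suc))
∑-applyUpTo-δ (suc M) h (suc t) f g (ℕ.s≤s t<M) eq = trans
  (cong₂ _+_ (eq 0) (∑-applyUpTo-δ M (h ∘ suc) t (f ∘ suc) g t<M (eq ∘ suc)))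
  (ℤₚ.+-identityˡ (f (suc t)))

coeff-monomial : ∀ m k → coeff (monomial m) k ≡ ⟦ m ℕ.≡ᵇ k ⟧
coeff-monomial zero    zero    = refl
coeff-monomial zero    (suc k) = refl
coeff-monomial (suc m) zero    = refl
coeff-monomial (suc m) (suc k) = coeff-monomial m k

degreeOK-≡ : ∀ a d → degreeOK a d ≡ true → a ≡ d
degreeOK-≡ 0 0 _ = refl
degreeOK-≡ 1 1 _ = refl
degreeOK-≡ (suc (suc a)) 0 ()
degreeOK-≡ (suc (suc a)) (suc d) ()
degreeOK-≡ 1 (suc (suc d)) ()

degreeOK-outdegree : ∀ a d → degreeOK a d ≡ true → ⟦ degreeOK 1 d ⟧ ≡ ℤ.+ d
degreeOK-outdegree 0 0 _ = refl
degreeOK-outdegree 1 1 _ = refl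
degreeOK-outdegree (suc (suc a)) 0 ()
degreeOK-outdegree (suc (suc a)) (suc d) ()
degreeOK-outdegree 1 (suc (suc d)) ()

degreeOK-positive : ∀ a d → degreeOK a (suc d) ≡ true → degreeOK 1 (suc d) ≡ true
degreeOK-positive 1 0 _ = refl
degreeOK-positive (suc (suc a)) d ()

degreeOK-≱2 : ∀ a d → ¬ degreeOK a (suc (suc d)) ≡ true
degreeOK-≱2 1             d ()
degreeOK-≱2 (suc (suc a)) d ()

-- Here `b` tells whether a word fixes the vertex and `a` is the indegree. A fixed vertex is a
-- preimage of itself without giving an arc, so `bump b a` is its number of preimages.
degreeOK-bump : ∀ a b → degreeOK a (if b then 0 else 1) ≡ (bump b a ℕ.≡ᵇ 1)
degreeOK-bump 0             true  = refl
degreeOK-bump 0             false = refl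
degreeOK-bump 1             true  = refl
degreeOK-bump 1             false = refl
degreeOK-bump (suc (suc a)) true  = refl
degreeOK-bump (suc (suc a)) false = refl

ArcSet : ℕ → Set
ArcSet n = Fin n → Fin n → Bool

-- The arc set { i → F i : F i ≢ i }.
arcsOf : ∀ {n} → (Fin n → Fin n) → ArcSet n
arcsOf F i = rowOf i (F i)

module _ {n} (S : SignedDigraph n) where

  isLinearSubᵇ-arcs : ∀ E → isLinearSubᵇ S E ≡ true → ∀ i j → E i j ≡ true → isArcᵇ S i j ≡ true
  isLinearSubᵇ-arcs E lin i j Eij = subst (λ b → implies b (isArcᵇ S i j) ≡ true) Eij
    (allFinᵇ-elim _ (allFinᵇ-elim _ (∧-elimˡ lin) i) j)

  isLinearSubᵇ-degrees : ∀ E → isLinearSubᵇ S E ≡ true → ∀ i → degreeOK (indeg E i) (outdeg E i) ≡ true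
  isLinearSubᵇ-degrees E lin = allFinᵇ-elim _ (∧-elimʳ {allFinᵇ (λ i → allFinᵇ (λ j → implies (E i j) (isArcᵇ S i j)))} lin)

  outdeg-cong : ∀ {E E′ : ArcSet n} → (∀ i → E i ≗ E′ i) → outdeg E ≗ outdeg E′
  outdeg-cong eq i = countTrue-cong (eq i)

  order-cong : ∀ {E E′ : ArcSet n} → (∀ i → E i ≗ E′ i) → order E ≡ order E′
  order-cong {E} {E′} eq = countTrue-cong (λ i → cong (degreeOK 1) (outdeg-cong {E} {E′} eq i))

  isLinearSubᵇ-cong : ∀ {E E′ : ArcSet n} → (∀ i → E i ≗ E′ i) → isLinearSubᵇ S E ≡ isLinearSubᵇ S E′
  isLinearSubᵇ-cong {E} {E′} eq = cong₂ _∧_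
    (allFinᵇ-cong (λ i → allFinᵇ-cong (λ j → cong (λ b → implies b (isArcᵇ S i j)) (eq i j))))
    (allFinᵇ-cong (λ i → cong₂ degreeOK (countTrue-cong (λ j → eq j i)) (outdeg-cong {E} {E′} eq i)))

  outdeg-arcsOf : ∀ (F : Fin n → Fin n) i → outdeg (arcsOf F) i ≡ (if i == F i then 0 else 1)
  outdeg-arcsOf F i with i == F i
  ... | true  = countTrue-false n
  ... | false = countTrue-== (F i)

  indeg-arcsOf : ∀ (F : Fin n → Fin n) j → bump (j == F j) (indeg (arcsOf F) j) ≡ occurrences j (tabulate F)
  indeg-arcsOf F j = ℤₚ.+-injective (begin
    ℤ.+ bump (j == F j) (indeg (arcsOf F) j)
      ≡⟨ +bump (j == F j) (indeg (arcsOf F) j) ⟩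
    ⟦ j == F j ⟧ + ℤ.+ indeg (arcsOf F) j
      ≡⟨ cong₂ _+_ (sym (∑-δ j (λ i → ⟦ i == F i ⟧))) (+countTrue (λ i → arcsOf F i j)) ⟩
    ∑ (allFin n) (λ i → ⟦ j == i ⟧ * ⟦ i == F i ⟧) + ∑ (allFin n) (λ i → ⟦ arcsOf F i j ⟧)
      ≡⟨ sym (∑-+ (allFin n) _ _) ⟩
    ∑ (allFin n) (λ i → ⟦ j == i ⟧ * ⟦ i == F i ⟧ + ⟦ arcsOf F i j ⟧)
      ≡⟨ ∑-cong (allFin n) merge ⟩
    ∑ (allFin n) (λ i → ⟦ F i == j ⟧)
      ≡⟨ ∑-tabulate-cong {h = id} {h′ = F} {f = λ i → ⟦ F i == j ⟧} {f′ = λ c → ⟦ c == j ⟧} (λ _ → refl) ⟩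
    ∑ (tabulate F) (λ c → ⟦ c == j ⟧)
      ≡⟨ sym (+occurrences j (tabulate F)) ⟩
    ℤ.+ occurrences j (tabulate F) ∎)
    where
    open ≡-Reasoning
    merge : ∀ i → ⟦ j == i ⟧ * ⟦ i == F i ⟧ + ⟦ arcsOf F i j ⟧ ≡ ⟦ F i == j ⟧
    merge i with i ≟ F i
    ... | yes i≡Fi = begin
      ⟦ j == i ⟧ * 1ℤ + 0ℤ    ≡⟨ trans (ℤₚ.+-identityʳ (⟦ j == i ⟧ * 1ℤ)) (ℤₚ.*-identityʳ ⟦ j == i ⟧) ⟩
      ⟦ j == i ⟧              ≡⟨ cong ⟦_⟧ (trans (==-sym j i) (cong (_== j) i≡Fi)) ⟩
      ⟦ F i == j ⟧            ∎
    ... | no _     = trans (cong (_+ ⟦ F i == j ⟧) (ℤₚ.*-zeroʳ ⟦ j == i ⟧)) (ℤₚ.+-identityˡ ⟦ F i == j ⟧)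

  moves-arcsOf : ∀ (F : Fin n → Fin n) i → degreeOK 1 (outdeg (arcsOf F) i) ≡ not (i == F i)
  moves-arcsOf F i rewrite outdeg-arcsOf F i with i == F i
  ... | true  = refl
  ... | false = refl

  isLinearSubᵇ-arcsOf : ∀ F → isLinearSubᵇ S (arcsOf F) ≡
    allFinᵇ (λ i → (i == F i) ∨ isArcᵇ S i (F i)) ∧ isPermᵇ (tabulate F) (allFin n)
  isLinearSubᵇ-arcsOf F = cong₂ _∧_
    (allFinᵇ-cong arcs)
    (trans (allFinᵇ-cong degrees) (sym (isPermᵇ-allFin (tabulate F))))
    where
    arcs : ∀ i → allFinᵇ (λ j → implies (arcsOf F i j) (isArcᵇ S i j)) ≡ (i == F i) ∨ isArcᵇ S i (F i)
    arcs i with i == F i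
    ... | true  = allFinᵇ-intro {n} (λ _ → true) (λ _ → refl)
    ... | false = allFinᵇ-implies-== (F i) (isArcᵇ S i)
    degrees : ∀ i → degreeOK (indeg (arcsOf F) i) (outdeg (arcsOf F) i) ≡ (occurrences i (tabulate F) ℕ.≡ᵇ 1)
    degrees i = trans (cong (degreeOK (indeg (arcsOf F) i)) (outdeg-arcsOf F i))
      (trans (degreeOK-bump (indeg (arcsOf F) i) (i == F i)) (cong (ℕ._≡ᵇ 1) (indeg-arcsOf F i)))

  c-as-∑ : ∀ m → ℤ.+ c S m ≡ ∑ (allArcSets n) (λ E → ⟦ isLinearSubᵇ S E ∧ (order E ℕ.≡ᵇ m) ⟧)
  c-as-∑ m = length-filterᵇ _ (allArcSets n)

  -- Makes the leading term z^n the summand j = 0. A nonempty arc set has a vertex of positive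
  -- outdegree, which the degree condition forces to count towards the order, so only the empty arc
  -- set remains.
  c-zero : ℤ.+ c S 0 ≡ 1ℤ
  c-zero = begin
    ℤ.+ c S 0
      ≡⟨ c-as-∑ 0 ⟩
    ∑ (allArcSets n) h
      ≡⟨ isolated-allFuns (λ _ → refl) (isolated-allFuns refl isolated-Bool n) n h
           (λ {E} {E′} eq → cong₂ (λ a b → ⟦ a ∧ (b ℕ.≡ᵇ 0) ⟧) (isLinearSubᵇ-cong {E} {E′} eq) (order-cong {E} {E′} eq))
           (λ E (i , j , Eij) → nonempty E i j Eij) ⟩
    h (λ _ _ → false)
      ≡⟨ cong ⟦_⟧ (∧-intro (∧-intro
           (allFinᵇ-intro {n} _ (λ _ → allFinᵇ-intro {n} _ (λ _ → refl)))
           (allFinᵇ-intro {n} _ (λ _ → cong₂ degreeOK (countTrue-false n) (countTrue-false n))))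
           (cong (ℕ._≡ᵇ 0) (trans (countTrue-cong {n} (λ _ → cong (degreeOK 1) (countTrue-false n))) (countTrue-false n)))) ⟩
    1ℤ ∎
    where
    open ≡-Reasoning
    h : ArcSet n → ℤ
    h E = ⟦ isLinearSubᵇ S E ∧ (order E ℕ.≡ᵇ 0) ⟧
    nonempty : ∀ E i j → E i j ≡ true → h E ≡ 0ℤ
    nonempty E i j Eij = ⟦⟧-refuted (λ both → contra (∧-elimˡ both) (∧-elimʳ {isLinearSubᵇ S E} both))
      where
      contra : isLinearSubᵇ S E ≡ true → ¬ (order E ℕ.≡ᵇ 0) ≡ true
      contra lin ord with d , outdeg≡ ← countTrue-≥1 (E i) j Eij
        with m , order≡ ← countTrue-≥1 (λ i → degreeOK 1 (outdeg E i)) i (subst (λ d → degreeOK 1 d ≡ true) (sym outdeg≡)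
          (degreeOK-positive _ d (subst (λ d → degreeOK (indeg E i) d ≡ true) outdeg≡ (isLinearSubᵇ-degrees E lin i))))
        with () ← trans (sym ord) (cong (ℕ._≡ᵇ 0) order≡)

  module _ (col : Fin n → Bool) where

    halfOrder : ArcSet n → ℕ
    halfOrder E = countTrue (λ i → col i ∧ degreeOK 1 (outdeg E i))

    -- An arc leaves a vertex coloured `true` exactly when it enters one coloured `false`. Counting
    -- these arcs by tails and by heads, with equal in- and outdegrees, gives equally many vertices
    -- of both colours.
    order≡2*halfOrder : (∀ i j → S i j ≢ nothing → col i ≢ col j) → ∀ E → isLinearSubᵇ S E ≡ true → order E ≡ 2 ℕ.* halfOrder E
    order≡2*halfOrder proper E lin = ℤₚ.+-injective (begin
      ℤ.+ order E
        ≡⟨ +countTrue (λ i → degreeOK 1 (outdeg E i)) ⟩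
      ∑ V (λ i → ⟦ degreeOK 1 (outdeg E i) ⟧)
        ≡⟨ ∑-cong V (λ i → trans (degreeOK-outdegree _ _ (isLinearSubᵇ-degrees E lin i)) (colourSplit (col i) (ℤ.+ outdeg E i))) ⟩
      ∑ V (λ i → ⟦ col i ⟧ * ℤ.+ outdeg E i + ⟦ not (col i) ⟧ * ℤ.+ outdeg E i)
        ≡⟨ ∑-+ V _ _ ⟩
      half + ∑ V (λ j → ⟦ not (col j) ⟧ * ℤ.+ outdeg E j)
        ≡⟨ cong (half +_) (sym doubleCount) ⟩
      half + half
        ≡⟨ cong₂ _+_ half≡ half≡ ⟩
      ℤ.+ (halfOrder E ℕ.+ halfOrder E)
        ≡⟨ cong (λ m → ℤ.+ (halfOrder E ℕ.+ m)) (sym (ℕₚ.+-identityʳ (halfOrder E))) ⟩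
      ℤ.+ (2 ℕ.* halfOrder E) ∎)
      where
      open ≡-Reasoning
      V = allFin n
      half = ∑ V (λ i → ⟦ col i ⟧ * ℤ.+ outdeg E i)

      colourSplit : ∀ b x → x ≡ ⟦ b ⟧ * x + ⟦ not b ⟧ * x
      colourSplit true  x = sym (trans (ℤₚ.+-identityʳ (1ℤ * x)) (ℤₚ.*-identityˡ x))
      colourSplit false x = sym (trans (ℤₚ.+-identityˡ (1ℤ * x)) (ℤₚ.*-identityˡ x))

      half≡ : half ≡ ℤ.+ halfOrder E
      half≡ = sym (trans (+countTrue (λ i → col i ∧ degreeOK 1 (outdeg E i))) (∑-cong V (λ i →
        trans (⟦∧⟧ (col i) _) (cong (⟦ col i ⟧ *_) (degreeOK-outdegree _ _ (isLinearSubᵇ-degrees E lin i))))))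

      arc-colours : ∀ i j → ⟦ col i ⟧ * ⟦ E i j ⟧ ≡ ⟦ not (col j) ⟧ * ⟦ E i j ⟧
      arc-colours i j with E i j in Eij
      ... | false = trans (ℤₚ.*-zeroʳ ⟦ col i ⟧) (sym (ℤₚ.*-zeroʳ ⟦ not (col j) ⟧))
      ... | true  = cong (λ b → ⟦ b ⟧ * 1ℤ)
        (Boolₚ.¬-not (proper i j (isArcᵇ⇒IsArc S (isLinearSubᵇ-arcs E lin i j Eij))))

      doubleCount : half ≡ ∑ V (λ j → ⟦ not (col j) ⟧ * ℤ.+ outdeg E j)
      doubleCount = begin
        ∑ V (λ i → ⟦ col i ⟧ * ℤ.+ outdeg E i)
          ≡⟨ ∑-cong V (λ i → trans (cong (⟦ col i ⟧ *_) (+countTrue (E i))) (sym (∑-*ˡ V ⟦ col i ⟧ _))) ⟩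
        ∑ V (λ i → ∑ V (λ j → ⟦ col i ⟧ * ⟦ E i j ⟧))
          ≡⟨ ∑-cong V (λ i → ∑-cong V (arc-colours i)) ⟩
        ∑ V (λ i → ∑ V (λ j → ⟦ not (col j) ⟧ * ⟦ E i j ⟧))
          ≡⟨ ∑-swap V V _ ⟩
        ∑ V (λ j → ∑ V (λ i → ⟦ not (col j) ⟧ * ⟦ E i j ⟧))
          ≡⟨ ∑-cong V (λ j → trans (∑-*ˡ V ⟦ not (col j) ⟧ _) (cong (⟦ not (col j) ⟧ *_) (sym (+countTrue (λ i → E i j))))) ⟩
        ∑ V (λ j → ⟦ not (col j) ⟧ * ℤ.+ indeg E j)
          ≡⟨ ∑-cong V (λ j → cong (λ d → ⟦ not (col j) ⟧ * ℤ.+ d) (degreeOK-≡ _ _ (isLinearSubᵇ-degrees E lin j))) ⟩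
        ∑ V (λ j → ⟦ not (col j) ⟧ * ℤ.+ outdeg E j) ∎

    -- The common form to which both sides of the theorem are brought: what `E` contributes to the
    -- coefficient of z^k.
    summand : ℕ → ArcSet n → ℤ
    summand k E = ⟦ isLinearSubᵇ S E ⟧ * (altSign (halfOrder E) * ⟦ order E ℕ.+ k ℕ.≡ᵇ n ⟧)

    summand-cong : ∀ k {E E′} → (∀ i → E i ≗ E′ i) → summand k E ≡ summand k E′
    summand-cong k {E} {E′} eq = cong₂ _*_ (cong ⟦_⟧ (isLinearSubᵇ-cong {E} {E′} eq)) (cong₂ _*_
      (cong altSign (countTrue-cong (λ i → cong (λ d → col i ∧ degreeOK 1 d) (outdeg-cong {E} {E′} eq i))))
      (cong (λ m → ⟦ m ℕ.+ k ℕ.≡ᵇ n ⟧) (order-cong {E} {E′} eq)))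

    summand-nonlinear : ∀ k {E} → ¬ isLinearSubᵇ S E ≡ true → summand k E ≡ 0ℤ
    summand-nonlinear k {E} ¬lin = cong (_* (altSign (halfOrder E) * ⟦ order E ℕ.+ k ℕ.≡ᵇ n ⟧)) (⟦⟧-refuted ¬lin)

    weight-sign : ∀ i j → (weight S col) i j ≡ ⟦ (i == j) ∨ isArcᵇ S i j ⟧ * signOf (col i ∧ not (i == j))
    weight-sign i j with i == j
    ... | true  = cong (λ b → 1ℤ * signOf b) (sym (Boolₚ.∧-zeroʳ (col i)))
    ... | false = cong (λ b → ⟦ isArcᵇ S i j ⟧ * signOf b) (sym (Boolₚ.∧-identityʳ (col i)))

    summand-arcsOf : ∀ k F → ⟦ isPermᵇ (tabulate F) (allFin n) ⟧ * monomialTerm (weight S col) _==_ n id F k ≡ summand k (arcsOf F)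
    summand-arcsOf k F = begin
      ⟦ perm ⟧ * monomialTerm (weight S col) _==_ n id F k
        ≡⟨ cong (⟦ perm ⟧ *_) (monomialTerm-∏ (weight S col) _==_ n id F k) ⟩
      ⟦ perm ⟧ * (∏ (λ i → (weight S col) i (F i)) * ⟦ countTrue fixed ℕ.≡ᵇ k ⟧)
        ≡⟨ cong₂ (λ x y → ⟦ perm ⟧ * (x * ⟦ y ⟧))
             (∏-signs _ _ _ (λ i → weight-sign i (F i)))
             (sym (+-≡ᵇ (order (arcsOf F)) (countTrue fixed) k
               (trans (cong (ℕ._+ countTrue fixed) (countTrue-cong (moves-arcsOf F))) (countTrue-not fixed)))) ⟩
      ⟦ perm ⟧ * (⟦ arcs ⟧ * altSign (countTrue (λ i → col i ∧ not (fixed i))) * ⟦ order (arcsOf F) ℕ.+ k ℕ.≡ᵇ n ⟧)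
        ≡⟨ cong (λ x → ⟦ perm ⟧ * (⟦ arcs ⟧ * altSign x * ⟦ order (arcsOf F) ℕ.+ k ℕ.≡ᵇ n ⟧))
             (sym (countTrue-cong (λ i → cong (col i ∧_) (moves-arcsOf F i)))) ⟩
      ⟦ perm ⟧ * (⟦ arcs ⟧ * altSign (halfOrder (arcsOf F)) * ⟦ order (arcsOf F) ℕ.+ k ℕ.≡ᵇ n ⟧)
        ≡⟨ lemma ⟦ perm ⟧ ⟦ arcs ⟧ (altSign (halfOrder (arcsOf F))) ⟦ order (arcsOf F) ℕ.+ k ℕ.≡ᵇ n ⟧ ⟩
      ⟦ arcs ⟧ * ⟦ perm ⟧ * (altSign (halfOrder (arcsOf F)) * ⟦ order (arcsOf F) ℕ.+ k ℕ.≡ᵇ n ⟧)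
        ≡⟨ cong (_* (altSign (halfOrder (arcsOf F)) * ⟦ order (arcsOf F) ℕ.+ k ℕ.≡ᵇ n ⟧))
             (sym (trans (cong ⟦_⟧ (isLinearSubᵇ-arcsOf F)) (⟦∧⟧ arcs perm))) ⟩
      summand k (arcsOf F) ∎
      where
      open ≡-Reasoning
      fixed : Fin n → Bool
      fixed i = i == F i
      perm = isPermᵇ (tabulate F) (allFin n)
      arcs = allFinᵇ (λ i → fixed i ∨ isArcᵇ S i (F i))
      lemma : ∀ p a s o → p * (a * s * o) ≡ a * p * (s * o)
      lemma = solve-∀

    permanent-arcSets : Loopless S → ∀ k → expansion 1ℤ (weight S col) _==_ (allFin n) (allFin n) k ≡ ∑ (allArcSets n) (summand k)
    permanent-arcSets loopless k = begin
      expansion 1ℤ (weight S col) _==_ (allFin n) (allFin n) k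
        ≡⟨ permanent-words (weight S col) _==_ n id (allFin⁺ n) k ⟩
      ∑ (allFuns n (allFin n)) (λ F → ⟦ isPermᵇ (tabulate F) (allFin n) ⟧ * monomialTerm (weight S col) _==_ n id F k)
        ≡⟨ ∑-cong (allFuns n (allFin n)) (summand-arcsOf k) ⟩
      ∑ (allFuns n (allFin n)) (λ F → summand k (arcsOf F))
        ≡⟨ sym (∑-arcSets n id (summand k) (summand-cong k)
             (λ E i j j′ j≢j′ Eij Eij′ → summand-nonlinear k {E} (two E i j j′ j≢j′ Eij Eij′))
             (λ E i Eii → summand-nonlinear k {E} (loop E i Eii))) ⟩
      ∑ (allArcSets n) (summand k) ∎
      where
      open ≡-Reasoning
      two : ∀ E i j j′ → j ≢ j′ → E i j ≡ true → E i j′ ≡ true → ¬ isLinearSubᵇ S E ≡ true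
      two E i j j′ j≢j′ Eij Eij′ lin with d , outdeg≡ ← countTrue-≥2 (E i) j j′ j≢j′ Eij Eij′ =
        degreeOK-≱2 (indeg E i) d (subst (λ d → degreeOK (indeg E i) d ≡ true) outdeg≡ (isLinearSubᵇ-degrees E lin i))
      loop : ∀ E i → E i i ≡ true → ¬ isLinearSubᵇ S E ≡ true
      loop E i Eii lin with () ← trans (sym (isLinearSubᵇ-arcs E lin i i Eii)) (isArcᵇ-nothing S (loopless i))

    -- After interchanging the sums, each linear subsidigraph is met by exactly one j, half its
    -- order.
    rhs-arcSets : (∀ i j → S i j ≢ nothing → col i ≢ col j) → ∀ k → coeff (rhsPoly S) k ≡ ∑ (allArcSets n) (summand k)
    rhs-arcSets proper k = begin
      coeff (rhsPoly S) k
        ≡⟨ coeff-+P (monomial n) _ k ⟩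
      coeff (monomial n) k + coeff (sumP p js) k
        ≡⟨ cong₂ _+_ (trans (coeff-monomial n k) zeroth) (trans (coeff-sumP p js k) (∑-cong js (λ j →
             trans (coeff-scaleP (altSign j * ℤ.+ c S (2 ℕ.* j)) (monomial (n ℕ.∸ 2 ℕ.* j)) k)
               (cong (altSign j * ℤ.+ c S (2 ℕ.* j) *_) (coeff-monomial (n ℕ.∸ 2 ℕ.* j) k))))) ⟩
      term 0 + ∑ js term
        ≡⟨ cong (λ js → term 0 + ∑ js term) (Listₚ.map-upTo suc (n / 2)) ⟩
      ∑ (upTo (suc (n / 2))) term
        ≡⟨ ∑-cong (upTo (suc (n / 2))) (λ j → trans (cong (λ x → altSign j * x * ⟦ n ℕ.∸ 2 ℕ.* j ℕ.≡ᵇ k ⟧) (c-as-∑ (2 ℕ.* j))) (expand-term j)) ⟩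
      ∑ (upTo (suc (n / 2))) (λ j → ∑ (allArcSets n) (λ E → s E j))
        ≡⟨ ∑-swap (upTo (suc (n / 2))) (allArcSets n) (λ j E → s E j) ⟩
      ∑ (allArcSets n) (λ E → ∑ (upTo (suc (n / 2))) (s E))
        ≡⟨ ∑-cong (allArcSets n) collect ⟩
      ∑ (allArcSets n) (summand k) ∎
      where
      open ≡-Reasoning
      js = map suc (upTo (n / 2))
      p : ℕ → Poly
      p j = scaleP (altSign j * ℤ.+ c S (2 ℕ.* j)) (monomial (n ℕ.∸ 2 ℕ.* j))
      term : ℕ → ℤ
      term j = altSign j * ℤ.+ c S (2 ℕ.* j) * ⟦ n ℕ.∸ 2 ℕ.* j ℕ.≡ᵇ k ⟧
      s : ArcSet n → ℕ → ℤ
      s E j = altSign j * ⟦ n ℕ.∸ 2 ℕ.* j ℕ.≡ᵇ k ⟧ * ⟦ isLinearSubᵇ S E ∧ (order E ℕ.≡ᵇ 2 ℕ.* j) ⟧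

      zeroth : ⟦ n ℕ.≡ᵇ k ⟧ ≡ term 0
      zeroth = sym (trans (cong (λ x → 1ℤ * x * ⟦ n ℕ.≡ᵇ k ⟧) c-zero) (ℤₚ.*-identityˡ ⟦ n ℕ.≡ᵇ k ⟧))

      expand-term : ∀ j → altSign j * ∑ (allArcSets n) (λ E → ⟦ isLinearSubᵇ S E ∧ (order E ℕ.≡ᵇ 2 ℕ.* j) ⟧) * ⟦ n ℕ.∸ 2 ℕ.* j ℕ.≡ᵇ k ⟧
        ≡ ∑ (allArcSets n) (λ E → s E j)
      expand-term j = trans (lemma (altSign j) (∑ (allArcSets n) _) ⟦ n ℕ.∸ 2 ℕ.* j ℕ.≡ᵇ k ⟧)
        (sym (∑-*ˡ (allArcSets n) (altSign j * ⟦ n ℕ.∸ 2 ℕ.* j ℕ.≡ᵇ k ⟧) _))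
        where
        lemma : ∀ a b c → a * b * c ≡ a * c * b
        lemma = solve-∀

      collect : ∀ E → ∑ (upTo (suc (n / 2))) (s E) ≡ summand k E
      collect E with isLinearSubᵇ S E in lin
      ... | false = ∑-zero (upTo (suc (n / 2))) (λ j → ℤₚ.*-zeroʳ (altSign j * ⟦ n ℕ.∸ 2 ℕ.* j ℕ.≡ᵇ k ⟧))
      ... | true  = begin
        ∑ (upTo (suc (n / 2))) (λ j → altSign j * ⟦ n ℕ.∸ 2 ℕ.* j ℕ.≡ᵇ k ⟧ * ⟦ order E ℕ.≡ᵇ 2 ℕ.* j ⟧)
          ≡⟨ ∑-applyUpTo-δ (suc (n / 2)) id t (λ j → altSign j * ⟦ n ℕ.∸ 2 ℕ.* j ℕ.≡ᵇ k ⟧) _ (ℕ.s≤s t≤n/2)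
               (λ j → trans (cong (λ b → altSign j * ⟦ n ℕ.∸ 2 ℕ.* j ℕ.≡ᵇ k ⟧ * ⟦ b ⟧)
                   (trans (cong (ℕ._≡ᵇ 2 ℕ.* j) order≡) (double-≡ᵇ t j)))
                 (ℤₚ.*-comm (altSign j * ⟦ n ℕ.∸ 2 ℕ.* j ℕ.≡ᵇ k ⟧) ⟦ t ℕ.≡ᵇ j ⟧)) ⟩
        altSign t * ⟦ n ℕ.∸ 2 ℕ.* t ℕ.≡ᵇ k ⟧
          ≡⟨ cong (λ b → altSign t * ⟦ b ⟧) (sym (+-≡ᵇ (2 ℕ.* t) (n ℕ.∸ 2 ℕ.* t) k (ℕₚ.m+[n∸m]≡n 2t≤n))) ⟩
        altSign t * ⟦ 2 ℕ.* t ℕ.+ k ℕ.≡ᵇ n ⟧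
          ≡⟨ cong (λ m → altSign t * ⟦ m ℕ.+ k ℕ.≡ᵇ n ⟧) (sym order≡) ⟩
        altSign t * ⟦ order E ℕ.+ k ℕ.≡ᵇ n ⟧
          ≡⟨ sym (ℤₚ.*-identityˡ (altSign t * ⟦ order E ℕ.+ k ℕ.≡ᵇ n ⟧)) ⟩
        1ℤ * (altSign t * ⟦ order E ℕ.+ k ℕ.≡ᵇ n ⟧) ∎
        where
        t = halfOrder E
        order≡ : order E ≡ 2 ℕ.* t
        order≡ = order≡2*halfOrder proper E lin
        -- This bound places `t` in the range of summation and makes the truncated difference of `n`
        -- and `2 * t` a true one.
        2t≤n : 2 ℕ.* t ℕ.≤ n
        2t≤n = subst₂ ℕ._≤_ order≡ (Listₚ.length-tabulate id) (Listₚ.length-filter _ (allFin n))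
        t≤n/2 : t ℕ.≤ n / 2
        t≤n/2 = subst (ℕ._≤ n / 2) (trans (cong (_/ 2) (ℕₚ.*-comm 2 t)) (m*n/n≡m t 2)) (/-monoˡ-≤ 2 2t≤n)
        double-≡ᵇ : ∀ a b → (2 ℕ.* a ℕ.≡ᵇ 2 ℕ.* b) ≡ (a ℕ.≡ᵇ b)
        double-≡ᵇ zero    zero    = refl
        double-≡ᵇ zero    (suc b) = refl
        double-≡ᵇ (suc a) zero    = refl
        double-≡ᵇ (suc a) (suc b) = trans
          (cong₂ ℕ._≡ᵇ_ (ℕₚ.+-suc a (a ℕ.+ 0)) (ℕₚ.+-suc b (b ℕ.+ 0))) (double-≡ᵇ a b)

theorem2p5 : (n : ℕ) (S : SignedDigraph n) → Loopless S → Bipartite S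
    → ((v : Fin n) (vs : List (Fin n)) → IsDirectedCycle S v vs → cycleLength v vs % 4 ≡ 0 → cycleSign S v vs ≡ -1ℤ)
    → ((v : Fin n) (vs : List (Fin n)) → IsDirectedCycle S v vs → cycleLength v vs % 4 ≡ 2 → cycleSign S v vs ≡ 1ℤ)
    → (k : ℕ) → coeff (charPoly S) k ≡ coeff (rhsPoly S) k
theorem2p5 n S loopless (col , proper) neg pos k = begin
  coeff (charPoly S) k
    ≡⟨ charPoly-permanent S col proper neg pos loopless k ⟩
  expansion 1ℤ (weight S col) _==_ (allFin n) (allFin n) k
    ≡⟨ permanent-arcSets S col loopless k ⟩
  ∑ (allArcSets n) (summand S col k)
    ≡⟨ sym (rhs-arcSets S col proper k) ⟩
  coeff (rhsPoly S) k ∎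
  where open ≡-Reasoning
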